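{- Let $n\ge 2$ and let $B_n$ be the hyperoctahedral group of permutations $w$ of $\pm[n]=\{\bar n,\ldots,\bar1,1,\ldots,n\}$ with $w(\bar i)=\overline{w(i)}$, regarded as the Coxeter group of type $B_n$. Fix the Coxeter element $c=(\bar1\,\bar2\,\cdots\,\bar n\,1\,2\,\cdots\,n)$. Then: (1) $c^{ -1}$ has $2n-1$ antiexceedances; (2) every element of $B_n$ other than $c^{ -1}$ has at most $2n-2$ antiexceedances; (3) for every $w\in B_n$, $\mathrm{aexc}(\mathsf{Pop}_T(w,c))=\mathrm{aexc}(w)-\mathrm{cyc}_{>1}(\pi_T(w,c))$.
   Context: Bars denote negatives ($\bar i=-i$). The reflections $T$ of $B_n$ are the elements $(i\,j)(\bar i\,\bar j)$ with $i\neq\pm j$ and $(i\,\bar i)$. Define the total order $\bar1\prec\bar2\prec\cdots\prec\bar n\prec1\prec2\prec\cdots\prec n$ on $\pm[n]$. An antiexceedance of $w\in B_n$ is an element $i\in\pm[n]$ with $i\prec w^{ -1}(i)$; $\mathrm{aexc}(w)$ is their number. $\mathrm{cyc}_{>1}(w)$ is the number of non-singleton cycles of $w$ as a permutation of $\pm[n]$. $\ell_T(w)$ is the minimal number of reflections with product $w$; absolute order $v\le_T w$ iff $\ell_T(wv^{ -1})=\ell_T(w)-\ell_T(v)$. $\mathrm{NC}(B_n,c)=[e,c]$ in absolute order, a lattice with join $\bigvee$. $\pi_T(w,c)=\bigvee_{t\in T,\ t\le_T w}t$ (join in $\mathrm{NC}(B_n,c)$, empty join $=e$) and $\mathsf{Pop}_T(w,c)=w\,\pi_T(w,c)^{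 -1}$. -}

module Defs where

open import Data.Nat using (ℕ; zero; suc; _+_; _∸_; _≤_; _<_; _≤ᵇ_; _<ᵇ_)
open import Data.Bool using (Bool; true; false; not; _∧_; if_then_else_)
open import Data.Fin using (Fin; toℕ; splitAt; join)
open import Data.Fin.Properties using (_≟_)
open import Data.List using (List; []; _∷_; length; foldr)
open import Data.List.Relation.Unary.All using (All)
open import Data.Sum using (_⊎_; inj₁; inj₂; swap)
open import Data.Product using (Σ; ∃; _×_; _,_)
open import Relation.Nullary using (¬_; does)
open import Relation.Binary.PropositionalEquality using (_≡_; _≢_; refl; cong; sym; trans)
open import Data.List using (allFin)

-- Points of ±[n] are encoded as Fin (n + n):
--   position k < n      (i.e. inject+ n i)  stands for  bar(i+1)
--   position n + i      (i.e. raise n i)    stands for  i+1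
-- so the total order  bar1 ≺ … ≺ barn ≺ 1 ≺ … ≺ n  is the usual order on positions.
Pt : ℕ → Set
Pt n = Fin (n + n)

neg : ∀ n → Pt n → Pt n
neg n k = join n n (swap (splitAt n k))

_≺_ : ∀ {n} → Pt n → Pt n → Set
i ≺ j = toℕ i < toℕ j

record Bn (n : ℕ) : Set where
  field
    fun   : Pt n → Pt n
    inv   : Pt n → Pt n
    invˡ  : ∀ i → inv (fun i) ≡ i
    invʳ  : ∀ i → fun (inv i) ≡ i
    odd   : ∀ i → fun (neg n i) ≡ neg n (fun i)
open Bn public

_≈_ : ∀ {n} → Bn n → Bn n → Set
v ≈ w = ∀ i → fun v i ≡ fun w i

_·_ : ∀ {n} → Bn n → Bn n → Bn n
fun  (v · w) i = fun v (fun w i)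
inv  (v · w) i = inv w (inv v i)
invˡ (v · w) i = trans (cong (inv w) (invˡ v (fun w i))) (invˡ w i)
invʳ (v · w) i = trans (cong (fun v) (invʳ w (inv v i))) (invʳ v i)
odd  (v · w) i = trans (cong (fun v) (odd w i)) (odd v (fun w i))

infixl 7 _·_
infix 8 _⁻¹
infix 4 _≈_ _≤T_

_⁻¹ : ∀ {n} → Bn n → Bn n
_⁻¹ {n} w = w⁻ where
  w⁻ : Bn n
  fun  w⁻ = inv w
  inv  w⁻ = fun w
  invˡ w⁻ = invʳ w
  invʳ w⁻ = invˡ w
  odd  w⁻ i = trans (cong (inv w) (sym (trans (odd w (inv w i)) (cong (neg n) (invʳ w i)))))
                 (invˡ w (neg n (inv w i)))

e : ∀ {n} → Bn n
fun  e i = i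
inv  e i = i
invˡ e i = refl
invʳ e i = refl
odd  e i = refl

tr : ∀ {m} → Fin m → Fin m → Fin m → Fin m
tr a b k = if does (k ≟ a) then b else (if does (k ≟ b) then a else k)

IsReflection : ∀ {n} → Bn n → Set
IsReflection {n} t =
  (Σ (Pt n) λ i → Σ (Pt n) λ j → i ≢ j × i ≢ neg n j ×
      (∀ k → fun t k ≡ tr i j (tr (neg n i) (neg n j) k)))
  ⊎ (Σ (Pt n) λ i → ∀ k → fun t k ≡ tr i (neg n i) k)

prod : ∀ {n} → List (Bn n) → Bn n
prod = foldr _·_ e

ReflFactorization : ∀ {n} → Bn n → List (Bn n) → Set
ReflFactorization w ts = All IsReflection ts × prod ts ≈ w

ℓT≡ : ∀ {n} → Bn n → ℕ → Set
ℓT≡ {n} w k =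
  (Σ (List (Bn n)) λ ts → length ts ≡ k × ReflFactorization w ts)
  × (∀ ts → ReflFactorization w ts → k ≤ length ts)

_≤T_ : ∀ {n} → Bn n → Bn n → Set
v ≤T w = Σ ℕ λ a → Σ ℕ λ b → Σ ℕ λ d →
  ℓT≡ w a × ℓT≡ v b × ℓT≡ (w · v ⁻¹) d × d ≡ a ∸ b

-- c is the Coxeter element (bar1 bar2 ⋯ barn 1 2 ⋯ n): in our encoding
-- the cyclic shift k ↦ k + 1 (mod 2n) of positions.
IsCoxeterElement : ∀ {n} → Bn n → Set
IsCoxeterElement {n} c =
  (∀ k → suc (toℕ k) < n + n → toℕ (fun c k) ≡ suc (toℕ k))
  × (∀ k → suc (toℕ k) ≡ n + n → toℕ (fun c k) ≡ 0)

-- π is the join, in the lattice NC(B_n,c) = [e,c] (absolute order),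
-- of the reflections t with t ≤_T w
IsπT : ∀ {n} → Bn n → Bn n → Bn n → Set
IsπT {n} w c π =
  π ≤T c
  × (∀ t → IsReflection t → t ≤T w → t ≤T π)
  × (∀ u → u ≤T c → (∀ t → IsReflection t → t ≤T w → t ≤T u) → π ≤T u)

-- Pop_T(w,c) = w π_T(w,c)⁻¹
Pop : ∀ {n} → Bn n → Bn n → Bn n
Pop w π = w · π ⁻¹

countᵇ : ∀ {A : Set} → (A → Bool) → List A → ℕ
countᵇ p [] = 0
countᵇ p (x ∷ xs) = if p x then suc (countᵇ p xs) else countᵇ p xs

aexc : ∀ {n} → Bn n → ℕ
aexc {n} w = countᵇ (λ i → toℕ i <ᵇ toℕ (inv w i)) (allFin (n + n))

allᵇ : ∀ {A : Set} → (A → Bool) → List A → Bool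
allᵇ p [] = true
allᵇ p (x ∷ xs) = p x ∧ allᵇ p xs

iter : ∀ {A : Set} → (A → A) → ℕ → A → A
iter f zero x = x
iter f (suc m) x = f (iter f m x)

-- i is the ≺-smallest element of a non-singleton cycle of w
-- (the cycle of i is { w^m(i) : m < 2n })
isCycleMin : ∀ {n} → Bn n → Pt n → Bool
isCycleMin {n} w i =
  not (does (fun w i ≟ i))
  ∧ allᵇ (λ m → toℕ i ≤ᵇ toℕ (iter (fun w) (toℕ m) i)) (allFin (n + n))

cyc>1 : ∀ {n} → Bn n → ℕ
cyc>1 {n} w = countᵇ (isCycleMin w) (allFin (n + n))

{-# OPTIONS --safe #-}
-- Cutting ±[n] cyclically, call two cuts w-related if the arc between them is
-- w-invariant; arcs are encoded by Boolean indicator functions, so this is an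
-- equivalence relation.  The join π_T(w,c) sends a to the last point, going
-- around from c a, whose cut is w-related to that of c a.  It lies below every u ≤_T c
-- lying above the reflections of w, since any such u can be lowered by reflections
-- within its cycles until it has this form.  Two facts about reflection length are
-- needed: if w a = d ≠ a, then the reflection exchanging a and d shortens w (an
-- exchange argument on factorizations), and the reflections of a minimal
-- factorization of w preserve every signed partition preserved by w.
-- Finally π_T(w,c) increases cyclically on its cycles, which contain those of w, so the
-- points j with π j < j, one for each nontrivial cycle of π, account for the change of aexc.
module Submission where

open import Defs
open import Data.Nat using (ℕ; zero; suc; pred; _+_; _∸_; _≤_; _<_; _≤ᵇ_; _<ᵇ_; s≤s; z≤n; >-nonZero)
open import Data.Nat.Properties using (+-0-commutativeMonoid; +-assoc; +-cancelʳ-≤; +-cancelˡ-<; +-cancelˡ-≤; +-comm; +-identityʳ; +-mono-≤; +-monoʳ-≤; +-monoˡ-<; +-monoˡ-≤; +-suc; +-∸-assoc; <-cmp; <-irrefl; <-trans; <⇒≤; <⇒≱; _<?_; _≤?_; m+[n∸m]≡n; m+n∸n≡m; m+n≤o⇒m≤o∸n; m∸n+n≡m; m∸n≤m; m≤m+n; m≤n+m; m≤n⇒m<n∨m≡n; m≤n⇒m∸n≡0; m≤n⇒m≤1+n; n∸n≡0; n≢0⇒n>0; suc-injective; suc-pred; ∸-monoˡ-<; ∸-monoˡ-≤; ≤-antisym; ≤-pred; ≤-refl; ≤-reflexive; ≤-total; ≤-trans; ≤ᵇ⇒≤; ≤⇒≯; ≤∧≢⇒<; ≮⇒≥; ≰⇒>)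 renaming (_≟_ to _ℕ≟_)
open import Data.Fin using (Fin; toℕ; fromℕ; fromℕ<; splitAt; join)
open import Data.Fin.Properties using (_≟_; toℕ-injective; toℕ<n; toℕ-fromℕ; toℕ-fromℕ<; toℕ-↑ˡ; toℕ-↑ʳ; splitAt-↑ˡ; splitAt-↑ʳ; join-splitAt; any?; all?)
open import Data.Fin.Permutation using (permutation)
open import Data.Bool using (Bool; true; false; not; _∧_; _xor_; if_then_else_; T)
open import Data.Bool.Properties using (xor-identityʳ; xor-comm; xor-same; not-¬; not-injective; ∧-conicalˡ; ∧-conicalʳ) renaming (_≟_ to _≟ᵇ_)
open import Data.List using (List; []; _∷_; length; tabulate; allFin)
open import Data.List.Relation.Unary.All using ([]; _∷_)
open import Data.List.Relation.Unary.Any using (here; there)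
open import Data.List.Membership.Propositional using (_∈_)
open import Data.List.Membership.Propositional.Properties using (∈-allFin)
open import Data.Sum using (_⊎_; inj₁; inj₂; swap)
open import Data.Sum.Properties using (swap-involutive)
open import Data.Product using (Σ; _×_; _,_; proj₁; proj₂)
open import Data.Empty using (⊥; ⊥-elim)
open import Data.Unit using (⊤; tt)
open import Function using (_∘_; id)
open import Relation.Nullary using (¬_; Dec; yes; no; does; contradiction; ¬?)
open import Relation.Nullary.Decidable using (map′; _×-dec_; dec-true; dec-false; decidable-stable)
open import Relation.Binary using (tri<; tri≈; tri>)
open import Relation.Binary.PropositionalEquality using (_≡_; _≢_; refl; sym; trans; cong; cong₂; subst; subst₂; module ≡-Reasoning)
open import Data.Bool.Solver using (module xor-∧-Solver)
open xor-∧-Solver using (solve; _:+_; _:=_; con)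
open import Algebra.Properties.CommutativeMonoid.Sum +-0-commutativeMonoid using (sum; sum-cong-≗; sum-permute; ∑-distrib-+)

-- The bridge to the definition of the join is the relation `w ⊑ u`: for every `a`, the arc between
-- the cuts `c a` and `u a` is `w`-invariant. For `u` below `c` it is equivalent to `u` lying above
-- all reflections below `w`, and it can be tested one point at a time. Cut relatedness is
-- transitive because indicators of arcs add modulo 2; hence the `xor`, which also makes it harmless
-- that an arc may be encoded by its complement. For `u = c` the point `u a` starts the walk from
-- `c a`, for `u = e` it ends it; so a small `u` has `u a` far along the walk, and the join takes
-- the furthest related cut everywhere. That this choice gives a permutation below `c` is never
-- checked directly: it is what remains when no further lowering is possible. The obstacle peculiar
-- to type B is the block stable under negation, which must be unique. For arcs this holds because
-- an arc or its complement contains no pair of opposite points.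

module Reflections (n : ℕ) where

  private variable
    k l : ℕ

  -- Negation and the reflections of the hyperoctahedral group

  neg-join : ∀ (s : Fin n ⊎ Fin n) → neg n (join n n s) ≡ join n n (swap s)
  neg-join (inj₁ i) rewrite splitAt-↑ˡ n i n = refl
  neg-join (inj₂ i) rewrite splitAt-↑ʳ n n i = refl

  neg-involutive : ∀ (x : Pt n) → neg n (neg n x) ≡ x
  neg-involutive x = trans (neg-join (swap (splitAt n x)))
    (trans (cong (join n n) (swap-involutive (splitAt n x))) (join-splitAt n n x))

  data Half (x : Pt n) : Set where
    lower : toℕ x < n → toℕ (neg n x) ≡ n + toℕ x → Half x
    upper : n ≤ toℕ x → toℕ (neg n x) < n → toℕ x ≡ n + toℕ (neg n x) → Half x

  half-join : ∀ (s : Fin n ⊎ Fin n) → Half (join n n s)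
  half-join (inj₁ i) = lower (subst (_< n) (sym (toℕ-↑ˡ i n)) (toℕ<n i))
    (trans (cong toℕ (neg-join (inj₁ i))) (trans (toℕ-↑ʳ n i) (cong (n +_) (sym (toℕ-↑ˡ i n)))))
  half-join (inj₂ i) = upper (subst (n ≤_) (sym (toℕ-↑ʳ n i)) (m≤m+n n (toℕ i)))
    (subst (_< n) (sym neg≡i) (toℕ<n i)) (trans (toℕ-↑ʳ n i) (cong (n +_) (sym neg≡i)))
    where
    neg≡i : toℕ (neg n (join n n (inj₂ i))) ≡ toℕ i
    neg≡i = trans (cong toℕ (neg-join (inj₂ i))) (toℕ-↑ˡ i n)

  half : ∀ (x : Pt n) → Half x
  half x = subst (Half) (join-splitAt n n x) (half-join (splitAt n x))

  neg≢ : ∀ (x : Pt n) → neg n x ≢ x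
  neg≢ x eq with half x
  ... | lower x<n e = <-irrefl refl (≤-trans x<n (subst (n ≤_) (trans (sym e) (cong toℕ eq)) (m≤m+n n _)))
  ... | upper n≤x -x<n _ = <-irrefl (cong toℕ eq) (≤-trans -x<n n≤x)

  neg-injective : ∀ {x y : Pt n} → neg n x ≡ neg n y → x ≡ y
  neg-injective {x} {y} eq = trans (sym (neg-involutive x)) (trans (cong (neg n) eq) (neg-involutive y))

  neg-flip : ∀ {x y : Pt n} → neg n x ≡ y → neg n y ≡ x
  neg-flip {x} refl = neg-involutive x

  fun-injective : (w : Bn n) → ∀ {x y} → fun w x ≡ fun w y → x ≡ y
  fun-injective w {x} {y} eq = trans (sym (invˡ w x)) (trans (cong (inv w) eq) (invˡ w y))

  -- The reflection exchanging i, j and neg i, neg j.  It is (i j)(-i -j) if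
  -- j ≠ ± i, it is (i -i) if j = - i, and the identity if j = i.
  opaque
    rf : Pt n → Pt n → Pt n → Pt n
    rf i j x with x ≟ i
    ... | yes _ = j
    ... | no  _ with x ≟ j
    ...   | yes _ = i
    ...   | no  _ with x ≟ neg n i
    ...     | yes _ = neg n j
    ...     | no  _ with x ≟ neg n j
    ...       | yes _ = neg n i
    ...       | no  _ = x

    rf-fst : (i j : Pt n) → rf i j i ≡ j
    rf-fst i j with i ≟ i
    ... | yes _ = refl
    ... | no ¬p = contradiction refl ¬p

    rf-snd : (i j : Pt n) → rf i j j ≡ i
    rf-snd i j with j ≟ i
    ... | yes p = p
    ... | no _ with j ≟ j
    ...   | yes _ = refl
    ...   | no ¬p = contradiction refl ¬p

    rf-neg-fst : (i j : Pt n) → rf i j (neg n i) ≡ neg n j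
    rf-neg-fst i j with neg n i ≟ i
    ... | yes p = contradiction p (neg≢ i)
    ... | no _ with neg n i ≟ j
    ...   | yes p = sym (neg-flip p)
    ...   | no _ with neg n i ≟ neg n i
    ...     | yes _ = refl
    ...     | no ¬p = contradiction refl ¬p

    rf-neg-snd : (i j : Pt n) → rf i j (neg n j) ≡ neg n i
    rf-neg-snd i j with neg n j ≟ i
    ... | yes p = sym (neg-flip p)
    ... | no _ with neg n j ≟ j
    ...   | yes p = contradiction p (neg≢ j)
    ...   | no _ with neg n j ≟ neg n i
    ...     | yes p = p
    ...     | no _ with neg n j ≟ neg n j
    ...       | yes _ = refl
    ...       | no ¬p = contradiction refl ¬p

    rf-off : (i j x : Pt n) → x ≢ i → x ≢ j → x ≢ neg n i → x ≢ neg n j → rf i j x ≡ x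
    rf-off i j x a b c d with x ≟ i
    ... | yes p = contradiction p a
    ... | no _ with x ≟ j
    ...   | yes p = contradiction p b
    ...   | no _ with x ≟ neg n i
    ...     | yes p = contradiction p c
    ...     | no _ with x ≟ neg n j
    ...       | yes p = contradiction p d
    ...       | no _ = refl

  data Place (i j : Pt n) : Pt n → Set where
    fst  : Place i j i
    snd  : Place i j j
    -fst : Place i j (neg n i)
    -snd : Place i j (neg n j)
    off  : ∀ {x} → x ≢ i → x ≢ j → x ≢ neg n i → x ≢ neg n j → Place i j x

  place : (i j x : Pt n) → Place i j x
  place i j x with x ≟ i | x ≟ j | x ≟ neg n i | x ≟ neg n j
  ... | yes refl | _ | _ | _ = fst
  ... | no _ | yes refl | _ | _ = snd
  ... | no _ | no _ | yes refl | _ = -fst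
  ... | no _ | no _ | no _ | yes refl = -snd
  ... | no a | no b | no c | no d = off a b c d

  rf-odd : (i j x : Pt n) → rf i j (neg n x) ≡ neg n (rf i j x)
  rf-odd i j x with place i j x
  ... | fst  = trans (rf-neg-fst i j) (cong (neg n) (sym (rf-fst i j)))
  ... | snd  = trans (rf-neg-snd i j) (cong (neg n) (sym (rf-snd i j)))
  ... | -fst = trans (cong (rf i j) (neg-involutive i)) (trans (rf-fst i j)
                (trans (sym (neg-involutive j)) (cong (neg n) (sym (rf-neg-fst i j)))))
  ... | -snd = trans (cong (rf i j) (neg-involutive j)) (trans (rf-snd i j)
                (trans (sym (neg-involutive i)) (cong (neg n) (sym (rf-neg-snd i j)))))
  ... | off a b c d = trans
    (rf-off i j (neg n x) (c ∘ sym ∘ neg-flip) (d ∘ sym ∘ neg-flip) (a ∘ neg-injective) (b ∘ neg-injective))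
    (cong (neg n) (sym (rf-off i j x a b c d)))

  rf-involutive : (i j x : Pt n) → rf i j (rf i j x) ≡ x
  rf-involutive i j x with place i j x
  ... | fst  = trans (cong (rf i j) (rf-fst i j)) (rf-snd i j)
  ... | snd  = trans (cong (rf i j) (rf-snd i j)) (rf-fst i j)
  ... | -fst = trans (cong (rf i j) (rf-neg-fst i j)) (rf-neg-snd i j)
  ... | -snd = trans (cong (rf i j) (rf-neg-snd i j)) (rf-neg-fst i j)
  ... | off a b c d = trans (cong (rf i j) (rf-off i j x a b c d)) (rf-off i j x a b c d)

  R : Pt n → Pt n → Bn n
  fun  (R i j) = rf i j
  inv  (R i j) = rf i j
  invˡ (R i j) = rf-involutive i j
  invʳ (R i j) = rf-involutive i j
  odd  (R i j) = rf-odd i j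

  rf-conj : (g : Bn n) (i j x : Pt n) → fun g (rf i j x) ≡ rf (fun g i) (fun g j) (fun g x)
  rf-conj g i j x with place i j x
  ... | fst  = trans (cong (fun g) (rf-fst i j)) (sym (rf-fst _ _))
  ... | snd  = trans (cong (fun g) (rf-snd i j)) (sym (rf-snd _ _))
  ... | -fst = trans (cong (fun g) (rf-neg-fst i j)) (trans (odd g j)
                (trans (sym (rf-neg-fst (fun g i) (fun g j))) (cong (rf _ _) (sym (odd g i)))))
  ... | -snd = trans (cong (fun g) (rf-neg-snd i j)) (trans (odd g i)
                (trans (sym (rf-neg-snd (fun g i) (fun g j))) (cong (rf _ _) (sym (odd g j)))))
  ... | off a b c d = trans (cong (fun g) (rf-off i j x a b c d)) (sym (rf-off _ _ _
    (a ∘ fun-injective g) (b ∘ fun-injective g)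
    (λ e → c (fun-injective g (trans e (sym (odd g i)))))
    (λ e → d (fun-injective g (trans e (sym (odd g j)))))))

  rf-sym : (i j x : Pt n) → rf i j x ≡ rf j i x
  rf-sym i j x with place i j x
  ... | fst  = trans (rf-fst i j) (sym (rf-snd j i))
  ... | snd  = trans (rf-snd i j) (sym (rf-fst j i))
  ... | -fst = trans (rf-neg-fst i j) (sym (rf-neg-snd j i))
  ... | -snd = trans (rf-neg-snd i j) (sym (rf-neg-fst j i))
  ... | off a b c d = trans (rf-off i j x a b c d) (sym (rf-off j i x b a d c))

  rf-neg-neg : (i j x : Pt n) → rf (neg n i) (neg n j) x ≡ rf i j x
  rf-neg-neg i j x with place i j x
  ... | fst  = trans (cong (rf _ _) (sym (neg-involutive i))) (trans (rf-neg-fst (neg n i) (neg n j)) (trans (neg-involutive j) (sym (rf-fst i j))))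
  ... | snd  = trans (cong (rf _ _) (sym (neg-involutive j))) (trans (rf-neg-snd (neg n i) (neg n j)) (trans (neg-involutive i) (sym (rf-snd i j))))
  ... | -fst = trans (rf-fst _ _) (sym (rf-neg-fst i j))
  ... | -snd = trans (rf-snd _ _) (sym (rf-neg-snd i j))
  ... | off a b c d = trans (rf-off _ _ x c d (λ e → a (trans e (neg-involutive i))) (λ e → b (trans e (neg-involutive j))))
                        (sym (rf-off i j x a b c d))

  ≈-by-±-support : (f g : Bn n) (a b : Pt n) → fun f a ≡ fun g a → fun f b ≡ fun g b →
    (∀ x → x ≢ a → x ≢ b → x ≢ neg n a → x ≢ neg n b → fun f x ≡ fun g x) → f ≈ g
  ≈-by-±-support f g a b ea eb eo x with place a b x
  ... | fst  = ea
  ... | snd  = eb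
  ... | -fst = trans (odd f a) (trans (cong (neg n) ea) (sym (odd g a)))
  ... | -snd = trans (odd f b) (trans (cong (neg n) eb) (sym (odd g b)))
  ... | off p q r s = eo x p q r s

  -- Signed partitions and factorizations into reflections

  -- The equivalences "same block" of signed partitions: a block equal to its
  -- negative (the zero block) is unique.
  record Admissible (_~_ : Pt n → Pt n → Set) : Set where
    field
      ~refl   : ∀ {x} → x ~ x
      ~sym    : ∀ {x y} → x ~ y → y ~ x
      ~trans  : ∀ {x y z} → x ~ y → y ~ z → x ~ z
      ~neg    : ∀ {x y} → x ~ y → neg n x ~ neg n y
      ~zero   : ∀ {x y} → x ~ neg n x → y ~ neg n y → x ~ y

    ~rf : ∀ {i j} → i ~ j → ∀ x → rf i j x ~ x
    ~rf {i} {j} i~j x with place i j x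
    ... | fst  = subst (_~ _) (sym (rf-fst i j)) (~sym i~j)
    ... | snd  = subst (_~ _) (sym (rf-snd i j)) i~j
    ... | -fst = subst (_~ _) (sym (rf-neg-fst i j)) (~neg (~sym i~j))
    ... | -snd = subst (_~ _) (sym (rf-neg-snd i j)) (~neg i~j)
    ... | off a b c d = subst (_~ _) (sym (rf-off i j x a b c d)) ~refl

  -- f = r₁ ∘ ⋯ ∘ r_k ∘ v for reflections r₁, …, r_k.
  data Chain (v : Pt n → Pt n) : (Pt n → Pt n) → ℕ → Set where
    done : ∀ {f} → (∀ x → f x ≡ v x) → Chain v f 0
    step : ∀ {f k} i j → i ≢ j → Chain v (rf i j ∘ f) k → Chain v f (suc k)

  Fac : (Pt n → Pt n) → ℕ → Set
  Fac = Chain id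

  chain-resp : {v f g : Pt n → Pt n} → (∀ x → f x ≡ g x) → Chain v f k → Chain v g k
  chain-resp e (done p) = done λ x → trans (sym (e x)) (p x)
  chain-resp e (step i j i≢j C) = step i j i≢j (chain-resp (λ x → cong (rf i j) (e x)) C)

  _++ᶜ_ : {u v f : Pt n → Pt n} → Chain v f k → Chain u v l → Chain u f (k + l)
  done p ++ᶜ D = chain-resp (λ x → sym (p x)) D
  step i j i≢j C ++ᶜ D = step i j i≢j (C ++ᶜ D)

  precomp : {v f : Pt n → Pt n} (g : Pt n → Pt n) → Chain v f k → Chain (v ∘ g) (f ∘ g) k
  precomp g (done p) = done (p ∘ g)
  precomp g (step i j i≢j C) = step i j i≢j (precomp g C)

  conjugate : (g : Bn n) {f : Pt n → Pt n} → Fac f k → Fac (fun g ∘ f ∘ inv g) k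
  conjugate g (done p) = done λ x → trans (cong (fun g) (p _)) (invʳ g x)
  conjugate g (step i j i≢j C) = step (fun g i) (fun g j) (i≢j ∘ fun-injective g)
    (chain-resp (λ x → rf-conj g i j _) (conjugate g C))

  module _ (_~_ : Pt n → Pt n → Set) where
    Pres : {v f : Pt n → Pt n} → Chain v f k → Set
    Pres (done _) = ⊤
    Pres (step i j _ C) = i ~ j × Pres C

    Pres-resp : {v f g : Pt n → Pt n} (e : ∀ x → f x ≡ g x) (C : Chain v f k) → Pres (chain-resp e C) → Pres C
    Pres-resp e (done _) _ = tt
    Pres-resp e (step i j _ C) (p , q) = p , Pres-resp _ C q

    Pres-++ : {u v f : Pt n → Pt n} (C : Chain v f k) (D : Chain u v l) → Pres (C ++ᶜ D) → Pres C
    Pres-++ (done _) D _ = tt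
    Pres-++ (step i j _ C) D (p , q) = p , Pres-++ C D q

  module _ {_~_ : Pt n → Pt n → Set} (adm : Admissible _~_) where
    open Admissible adm

    Pres-end : {v f : Pt n → Pt n} (C : Chain v f k) → Pres _~_ C → ∀ x → v x ~ f x
    Pres-end (done p) _ x = subst (_~ _) (p x) ~refl
    Pres-end (step i j _ C) (p , q) x = ~trans (Pres-end C q x) (~rf p _)

    -- The endpoints of a reflection are determined only up to order and simultaneous negation, so
    -- any moved point and its image may serve as endpoints; `~` respects both changes.
    rf-endpoint : ∀ i j d → rf i j d ≢ d →
      (∀ x → rf i j x ≡ rf (rf i j d) d x) × (rf i j d ~ d → i ~ j)
    rf-endpoint i j d ne with place i j d
    ... | fst  = (λ x → trans (rf-sym i j x) (cong (λ b → rf b i x) (sym (rf-fst i j))))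
               , λ p → ~sym (subst (_~ i) (rf-fst i j) p)
    ... | snd  = (λ x → cong (λ b → rf b j x) (sym (rf-snd i j))) , subst (_~ j) (rf-snd i j)
    ... | -fst = (λ x → trans (trans (rf-sym i j x) (sym (rf-neg-neg j i x))) (cong (λ b → rf b (neg n i) x) (sym (rf-neg-fst i j))))
               , λ p → ~sym (subst₂ _~_ (neg-involutive j) (neg-involutive i) (~neg (subst (_~ _) (rf-neg-fst i j) p)))
    ... | -snd = (λ x → trans (sym (rf-neg-neg i j x)) (cong (λ b → rf b (neg n j) x) (sym (rf-neg-snd i j))))
               , λ p → subst₂ _~_ (neg-involutive i) (neg-involutive j) (~neg (subst (_~ _) (rf-neg-snd i j) p))
    ... | off p q r s = contradiction (rf-off i j d p q r s) ne

    -- In a dihedral group the product of three reflections is a reflection.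
    triple : ∀ a b d → a ≢ b → b ≢ d → a ≢ d →
      Σ (Pt n) λ x → Σ (Pt n) λ y → x ≢ y × (∀ k → rf x y (rf a d k) ≡ rf a b (rf b d k)) × (x ~ y → a ~ d → a ~ b × b ~ d)
    triple a b d a≢b b≢d a≢d with a ≟ neg n d | a ≟ neg n b
    -- Conjugating by `rf b d` works only if that reflection fixes `a`, so `a = neg n d` and
    -- `a = neg n b` are treated apart. In the present case `rf x y` and `rf a d` are both sign
    -- changes, and only uniqueness of the zero block relates `b` to `d`.
    ... | yes refl | _ = b , neg n b , neg≢ b ∘ sym , eq , rel
      where
      eq : R b (neg n b) · R (neg n d) d ≈ R (neg n d) b · R b d
      eq = ≈-by-±-support (R b (neg n b) · R (neg n d) d) (R (neg n d) b · R b d) d b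
        (trans (cong (rf b (neg n b)) (rf-snd _ d)) (trans (rf-off b (neg n b) (neg n d) a≢b (b≢d ∘ sym ∘ neg-injective) (b≢d ∘ sym ∘ neg-injective) (λ e → a≢b (trans e (neg-involutive b))))
          (sym (trans (cong (rf (neg n d) b) (rf-snd b d)) (rf-snd _ b)))))
        (trans (cong (rf b (neg n b)) (rf-off (neg n d) d b (a≢b ∘ sym) b≢d (λ e → b≢d (trans e (neg-involutive d))) (a≢b ∘ sym)))
          (trans (rf-fst b (neg n b)) (sym (trans (cong (rf (neg n d) b) (trans (rf-fst b d) (sym (neg-involutive d)))) (rf-neg-fst (neg n d) b)))))
        (λ x p q r s → trans (trans (cong (rf b (neg n b)) (rf-off _ _ x r p (λ e → p (trans e (neg-involutive d))) r)) (rf-off b (neg n b) x q s s (λ e → q (trans e (neg-involutive b)))))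
          (sym (trans (cong (rf (neg n d) b) (rf-off b d x q p s r)) (rf-off (neg n d) b x r q (λ e → p (trans e (neg-involutive d))) s))))
      rel : b ~ neg n b → neg n d ~ d → neg n d ~ b × b ~ d
      rel p q = ~trans q (~zero (~sym q) p) , ~zero p (~sym q)
    ... | no _ | yes refl = d , neg n d , neg≢ d ∘ sym , eq , rel
      where
      eq : R d (neg n d) · R (neg n b) d ≈ R (neg n b) b · R b d
      eq = ≈-by-±-support (R d (neg n d) · R (neg n b) d) (R (neg n b) b · R b d) b d
        (trans (cong (rf d (neg n d)) (trans (cong (rf (neg n b) d) (sym (neg-involutive b))) (rf-neg-fst (neg n b) d)))
          (trans (rf-snd d (neg n d)) (sym (trans (cong (rf (neg n b) b) (rf-fst b d)) (rf-off (neg n b) b d (a≢d ∘ sym) (b≢d ∘ sym) (λ e → b≢d (sym (trans e (neg-involutive b)))) (a≢d ∘ sym))))))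
        (trans (cong (rf d (neg n d)) (rf-snd (neg n b) d)) (trans (rf-off d (neg n d) (neg n b) a≢d (b≢d ∘ neg-injective) (b≢d ∘ neg-injective) (λ e → a≢d (trans e (neg-involutive d))))
          (sym (trans (cong (rf (neg n b) b) (rf-snd b d)) (rf-snd (neg n b) b)))))
        (λ x p q r s → trans (trans (cong (rf d (neg n d)) (rf-off (neg n b) d x r q (λ e → p (trans e (neg-involutive b))) s)) (rf-off d (neg n d) x q s s (λ e → q (trans e (neg-involutive d)))))
          (sym (trans (cong (rf (neg n b) b) (rf-off b d x p q r s)) (rf-off (neg n b) b x r p (λ e → p (trans e (neg-involutive b))) r))))
      rel : d ~ neg n d → neg n b ~ d → neg n b ~ b × b ~ d
      rel p q = ~trans q (~sym b~d) , b~d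
        where
        b~d : b ~ d
        b~d = ~trans (subst (_~ neg n d) (neg-involutive b) (~neg q)) (~sym p)
    ... | no p | no q = b , d , b≢d , (λ k → trans (rf-conj (R b d) a d k) (cong₂ (λ s t → rf s t (rf b d k)) (rf-off b d a a≢b a≢d q p) (rf-snd b d)))
                      , λ b~d a~d → ~trans a~d (~sym b~d) , b~d

-- Reflection length and the absolute order

module Lengths (n : ℕ) where
  open Reflections n

  private variable
    k l : ℕ

  module _ {_~_ : Pt n → Pt n → Set} (adm : Admissible _~_) where
    open Admissible adm

    -- Induction along the factorization. An outermost reflection fixing `d` is conjugated by
    -- `rf a d`. Otherwise it equals `rf b d` for some `b`: it is dropped if `b = a`, and else
    -- `triple` trades it for another reflection while the recursion continues with `a` and `b`. The
    -- last component carries compatibility with `~` back from the shortened factorization, as the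
    -- induction in `Min-pres` requires.
    exchange-pres : {f : Pt n → Pt n} (F : Fac f k) (a d : Pt n) → f a ≡ d → a ≢ d →
      Σ ℕ λ l → k ≡ suc l × Σ (Fac (rf a d ∘ f) l) λ G → a ~ d → Pres _~_ G → Pres _~_ F
    exchange-pres (done p) a d fa≡d a≢d = contradiction (trans (sym (p a)) fa≡d) a≢d
    exchange-pres {f = f} (step i j i≢j F) a d fa≡d a≢d with rf i j d ≟ d
    ... | yes fixed with exchange-pres F a d (trans (cong (rf i j) fa≡d) fixed) a≢d
    ...   | l , refl , G , back = suc l , refl
          , step (rf a d i) (rf a d j) (i≢j ∘ fun-injective (R a d)) (chain-resp (λ x → rf-conj (R a d) i j (f x)) G)
          , λ { a~d (p , q) → ~trans (~sym (~rf a~d i)) (~trans p (~rf a~d j))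
                            , back a~d (Pres-resp _~_ (λ x → rf-conj (R a d) i j (f x)) G q) }
    exchange-pres {f = f} (step i j i≢j F) a d fa≡d a≢d | no moved with rf-endpoint adm i j d moved | rf i j d ≟ a
    ... | same , rel | yes b≡a = _ , refl , chain-resp agree F
          , λ a~d q → rel (subst (_~ d) (sym b≡a) a~d) , Pres-resp _~_ agree F q
      where
      agree : ∀ x → rf i j (f x) ≡ rf a d (f x)
      agree x = trans (same (f x)) (cong (λ b → rf b d (f x)) b≡a)
    ... | same , rel | no b≢a
      with exchange-pres F a (rf i j d) (cong (rf i j) fa≡d) (b≢a ∘ sym)
         | triple adm a (rf i j d) d (b≢a ∘ sym) moved a≢d
    ...   | l , refl , G , back | x , y , x≢y , eq , rel′ = suc l , refl , step x y x≢y (chain-resp agree G)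
          , λ { a~d (p , q) → rel (proj₂ (rel′ p a~d)) , back (proj₁ (rel′ p a~d)) (Pres-resp _~_ agree G q) }
      where
      agree : ∀ z → rf a (rf i j d) (rf i j (f z)) ≡ rf x y (rf a d (f z))
      agree z = trans (cong (rf a (rf i j d)) (same (f z))) (sym (eq (f z)))

  exchange : {f : Pt n → Pt n} (a : Pt n) → f a ≢ a → Fac f k → Σ ℕ λ l → k ≡ suc l × Fac (rf a (f a) ∘ f) l
  exchange {f = f} a fa≢a F with exchange-pres {_~_ = λ _ _ → ⊤} _ F a (f a) refl (fa≢a ∘ sym)
  ... | l , eq , G , _ = l , eq , G

  Min : (Pt n → Pt n) → ℕ → Set
  Min f k = Fac f k × (∀ l → Fac f l → k ≤ l)

  Min-unique : {f g : Pt n → Pt n} → (∀ x → f x ≡ g x) → Min f k → Min g l → k ≡ l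
  Min-unique e (F , F-min) (G , G-min) =
    ≤-antisym (F-min _ (chain-resp (λ x → sym (e x)) G)) (G-min _ (chain-resp e F))

  Min-resp : {f g : Pt n → Pt n} → (∀ x → f x ≡ g x) → Min f k → Min g k
  Min-resp e (F , F-min) = chain-resp e F , λ l G → F-min l (chain-resp (λ x → sym (e x)) G)

  Min-up : {f : Pt n → Pt n} (a : Pt n) → f a ≢ a → Min (rf a (f a) ∘ f) k → Min f (suc k)
  Min-up {k = k} {f = f} a fa≢a (F , F-min) = step a (f a) (fa≢a ∘ sym) F , bound
    where
    bound : ∀ l → Fac f l → suc k ≤ l
    bound l G with exchange a fa≢a G
    ... | m , refl , H = s≤s (F-min m H)

  Min-down : {f : Pt n → Pt n} {i j : Pt n} → i ≢ j → Min f (suc k) → Fac (rf i j ∘ f) k → Min (rf i j ∘ f) k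
  Min-down i≢j (_ , F-min) G = G , λ l H → ≤-pred (F-min (suc l) (step _ _ i≢j H))

  Min-exchange : {f : Pt n → Pt n} (a : Pt n) → f a ≢ a → Min f k → Σ ℕ λ l → k ≡ suc l × Min (rf a (f a) ∘ f) l
  Min-exchange a fa≢a M@(F , _) with exchange a fa≢a F
  ... | l , refl , G = l , refl , Min-down (fa≢a ∘ sym) M G

  -- `L` contains every point that may still be moved. Exchanging at `a` fixes `a` and moves no
  -- point that was fixed, so `a` can be removed from `L`.
  Min-exists-within : (L : List (Pt n)) (w : Bn n) → (∀ x → x ∈ L ⊎ fun w x ≡ x) → Σ ℕ (Min (fun w))
  Min-exists-within [] w supp = 0 , done fix , λ _ _ → z≤n
    where
    fix : ∀ x → fun w x ≡ x
    fix x with supp x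
    ... | inj₂ e = e
  Min-exists-within (a ∷ L) w supp with fun w a ≟ a
  ... | yes wa≡a = Min-exists-within L w supp′
    where
    supp′ : ∀ x → x ∈ L ⊎ fun w x ≡ x
    supp′ x with supp x
    ... | inj₁ (here refl) = inj₂ wa≡a
    ... | inj₁ (there x∈L) = inj₁ x∈L
    ... | inj₂ e = inj₂ e
  ... | no wa≢a = let (k , M) = Min-exists-within L (R a (fun w a) · w) supp′ in suc k , Min-up a wa≢a M
    where
    supp′ : ∀ x → x ∈ L ⊎ rf a (fun w a) (fun w x) ≡ x
    supp′ x with supp x
    ... | inj₁ (here refl) = inj₂ (rf-snd a (fun w a))
    ... | inj₁ (there x∈L) = inj₁ x∈L
    ... | inj₂ e = inj₂ (trans (cong (rf a (fun w a)) e) (rf-off a (fun w a) x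
            (λ { refl → wa≢a e })
            (λ { refl → wa≢a (fun-injective w e) })
            (λ { refl → wa≢a (neg-injective (trans (sym (odd w a)) e)) })
            (λ { refl → wa≢a (fun-injective w (neg-injective (trans (sym (odd w (fun w a))) e))) })))

  Min-exists : (w : Bn n) → Σ ℕ (Min (fun w))
  Min-exists w = Min-exists-within (allFin (n + n)) w (λ x → inj₁ (∈-allFin x))

  -- Carter's lemma, with admissible equivalences in place of fixed spaces.
  Min-pres : {_~_ : Pt n → Pt n → Set} (adm : Admissible _~_) {f : Pt n → Pt n} →
    (∀ x → f x ~ x) → (F : Fac f k) → (∀ l → Fac f l → k ≤ l) → Pres _~_ F
  Min-pres adm _ (done _) _ = tt
  Min-pres {k = suc k} {_~_ = _~_} adm {f} f~ F F-min with any? (λ x → ¬? (f x ≟ x))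
  ... | no allfixed = contradiction (F-min 0 (done λ x → decidable-stable (f x ≟ x) λ ne → allfixed (x , ne))) λ ()
  ... | yes (a , fa≢a) with exchange-pres adm F a (f a) refl (fa≢a ∘ sym)
  ...   | l , refl , G , back = back (~sym (f~ a)) (Min-pres adm
            (λ x → ~trans (~rf (~sym (f~ a)) (f x)) (f~ x)) G
            (proj₂ (Min-down (fa≢a ∘ sym) (F , F-min) G)))
    where open Admissible adm

  -- `Min-exchange` covers consecutive points of a cycle; induction on the number `m` of steps
  -- extends it to any two distinct points of a cycle.
  orbit-reflection : (v : Bn n) (i : Pt n) (m : ℕ) → iter (fun v) m i ≢ i →
    Σ ℕ λ k → Min (fun v) (suc k) × Min (rf i (iter (fun v) m i) ∘ fun v) k
  orbit-reflection v i zero j≢i = contradiction refl j≢i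
  orbit-reflection v i (suc m) vj≢i with iter (fun v) m i ≟ i
  ... | yes j≡i rewrite j≡i with Min-exists v
  ...   | k , M with Min-exchange i vj≢i M
  ...     | l , refl , M′ = l , M , M′
  orbit-reflection v i (suc m) vj≢i | no j≢i with orbit-reflection v i m j≢i
  ... | k , M , M′ with Min-exchange j v′j≢j M′
    where
    j = iter (fun v) m i
    v′j≢j : rf i j (fun v j) ≢ j
    v′j≢j agree = vj≢i (trans (sym (rf-involutive i j (fun v j))) (trans (cong (rf i j) agree) (rf-snd i j)))
  -- Two exchanges give an element two shorter than `v`. By conjugation it is
  -- `rf i j ∘ rf i (fun v j) ∘ v`, so `rf i (fun v j) ∘ v` is at most one longer than it.
  ...   | l , refl , M″ = suc l , M , Min-down (vj≢i ∘ sym) M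
           (step i j (j≢i ∘ sym) (chain-resp agree (proj₁ M″)))
    where
    j = iter (fun v) m i
    t = rf i j (fun v j)
    agree : ∀ x → rf j t (rf i j (fun v x)) ≡ rf i j (rf i (fun v j) (fun v x))
    agree x = sym (trans (rf-conj (R i j) i (fun v j) (fun v x))
      (cong (λ z → rf z t (rf i j (fun v x))) (rf-fst i j)))

  infix 4 _⊴_
  -- The absolute order in terms of chains: a minimal factorization of `v` ends in one of `u`. This
  -- form contains neither inverses nor truncated subtraction.
  _⊴_ : Bn n → Bn n → Set
  u ⊴ v = Σ ℕ λ j → Σ ℕ λ k → Chain (fun u) (fun v) j × Min (fun u) k × Min (fun v) (j + k)

  -- By `Min-pres` every reflection of a minimal factorization of `v` through `u` stays within
  -- classes, so `u x` and `v x` are related.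
  ⊴-pres : {_~_ : Pt n → Pt n → Set} (adm : Admissible _~_) (u v : Bn n) → u ⊴ v →
    (∀ x → fun v x ~ x) → ∀ x → fun u x ~ x
  ⊴-pres {_~_} adm u v (j , k , C , (F , _) , (_ , V-min)) v~ x =
    ~trans (Pres-end adm C (Pres-++ _~_ C F (Min-pres adm v~ (C ++ᶜ F) V-min)) x) (v~ x)
    where open Admissible adm

  ⊴-refl : (u : Bn n) → u ⊴ u
  ⊴-refl u = let (k , M) = Min-exists u in 0 , k , done (λ _ → refl) , M , M

  ⊴-trans : (u v w : Bn n) → u ⊴ v → v ⊴ w → u ⊴ w
  ⊴-trans u v w (j , k , C , U , V) (j′ , k′ , C′ , V′ , W)
    with refl ← Min-unique {f = fun v} {g = fun v} (λ _ → refl) V′ V =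
    j′ + j , k , (C′ ++ᶜ C) , U , subst (Min (fun w)) (sym (+-assoc j′ j k)) W

  ⊴-respˡ : (u u′ v : Bn n) → u ≈ u′ → u ⊴ v → u′ ⊴ v
  ⊴-respˡ u u′ v e (j , k , C , U , V) = j , k
    , subst (Chain (fun u′) (fun v)) (+-identityʳ j) (C ++ᶜ done e) , Min-resp e U , V

  -- Chains multiply on the left, so the factorization of `rf i j ∘ fun w` is conjugated by
  -- `rf i j`; this moves the reflection to the right end.
  reflection-⊴ : (w : Bn n) (i j : Pt n) → i ≢ j → Min (fun w) (suc k) → Min (rf i j ∘ fun w) k → R i j ⊴ w
  reflection-⊴ {k} w i j i≢j M (F , _) = k , 1
    , chain-resp (λ x → trans (rf-involutive i j _) (cong (fun w) (rf-involutive i j x)))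
        (precomp (rf i j) (conjugate (R i j) F))
    , (step i j i≢j (done λ x → rf-involutive i j x) , atLeastOne)
    , subst (Min (fun w)) (sym (+-comm k 1)) M
    where
    atLeastOne : ∀ l → Fac (rf i j) l → 1 ≤ l
    atLeastOne zero (done p) = contradiction (trans (sym (p i)) (rf-fst i j)) i≢j
    atLeastOne (suc l) _ = s≤s z≤n

  reflect-⊴ : (u : Bn n) (i j : Pt n) → Min (fun u) (suc k) → Min (rf i j ∘ fun u) k → i ≢ j → R i j · u ⊴ u
  reflect-⊴ {k} u i j M M′ i≢j = 1 , k , step i j i≢j (done λ _ → refl) , M′ , M

  -- Agreement with `IsReflection`, `ℓT≡` and `_≤T_`

  tr-fst : (a b : Pt n) → tr a b a ≡ b
  tr-fst a b rewrite dec-true (a ≟ a) refl = refl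

  tr-snd : (a b : Pt n) → tr a b b ≡ a
  tr-snd a b with b ≟ a
  ... | yes p = p
  ... | no _ rewrite dec-true (b ≟ b) refl = refl

  tr-off : (a b x : Pt n) → x ≢ a → x ≢ b → tr a b x ≡ x
  tr-off a b x p q rewrite dec-false (x ≟ a) p | dec-false (x ≟ b) q = refl

  tr-tr : (i j : Pt n) → i ≢ j → i ≢ neg n j → ∀ x → tr i j (tr (neg n i) (neg n j) x) ≡ rf i j x
  tr-tr i j i≢j i≢-j x with place i j x
  ... | fst = trans (cong (tr i j) (tr-off _ _ i (neg≢ i ∘ sym) i≢-j)) (trans (tr-fst i j) (sym (rf-fst i j)))
  ... | snd = trans (cong (tr i j) (tr-off _ _ j (i≢-j ∘ sym ∘ neg-flip ∘ sym) (neg≢ j ∘ sym))) (trans (tr-snd i j) (sym (rf-snd i j)))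
  ... | -fst = trans (cong (tr i j) (tr-fst (neg n i) (neg n j))) (trans (tr-off i j _ (i≢-j ∘ sym) (neg≢ j)) (sym (rf-neg-fst i j)))
  ... | -snd = trans (cong (tr i j) (tr-snd (neg n i) (neg n j))) (trans (tr-off i j _ (neg≢ i) (i≢-j ∘ sym ∘ neg-flip)) (sym (rf-neg-snd i j)))
  ... | off a b c d = trans (cong (tr i j) (tr-off _ _ x c d)) (trans (tr-off i j x a b) (sym (rf-off i j x a b c d)))

  tr-neg : (i x : Pt n) → tr i (neg n i) x ≡ rf i (neg n i) x
  tr-neg i x with place i (neg n i) x
  ... | fst = trans (tr-fst i _) (sym (rf-fst i _))
  ... | snd = trans (tr-snd i (neg n i)) (sym (rf-snd i _))
  ... | -fst = trans (tr-snd i (neg n i)) (sym (rf-snd i _))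
  ... | -snd rewrite neg-involutive i = trans (tr-fst i _) (sym (rf-fst i _))
  ... | off a b c d = trans (tr-off i _ x a b) (sym (rf-off i _ x a b c d))

  reflection⇒rf : (t : Bn n) → IsReflection t → Σ (Pt n) λ i → Σ (Pt n) λ j → i ≢ j × (∀ x → fun t x ≡ rf i j x)
  reflection⇒rf t (inj₁ (i , j , i≢j , i≢-j , e)) = i , j , i≢j , λ x → trans (e x) (tr-tr i j i≢j i≢-j x)
  reflection⇒rf t (inj₂ (i , e)) = i , neg n i , neg≢ i ∘ sym , λ x → trans (e x) (tr-neg i x)

  R-reflection : (i j : Pt n) → i ≢ j → IsReflection (R i j)
  R-reflection i j i≢j with i ≟ neg n j
  ... | yes i≡-j = inj₂ (i , λ x → trans (cong (λ z → rf i z x) (sym (neg-flip (sym i≡-j)))) (sym (tr-neg i x)))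
  ... | no i≢-j = inj₁ (i , j , i≢j , i≢-j , λ x → sym (tr-tr i j i≢j i≢-j x))

  factorization⇒Fac : (ts : List (Bn n)) (w : Bn n) → ReflFactorization w ts → Fac (fun w) (length ts)
  factorization⇒Fac [] w (_ , e) = done λ x → sym (e x)
  factorization⇒Fac (t ∷ ts) w (t-refl ∷ ts-refl , e) with reflection⇒rf t t-refl
  ... | i , j , i≢j , t≡rf = step i j i≢j (factorization⇒Fac ts (R i j · w) (ts-refl , λ x →
          sym (trans (cong (rf i j) (trans (sym (e x)) (t≡rf _))) (rf-involutive i j _))))

  Fac⇒factorization : {f : Pt n → Pt n} → Fac f k → (w : Bn n) → (∀ x → fun w x ≡ f x) →
    Σ (List (Bn n)) λ ts → length ts ≡ k × ReflFactorization w ts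
  Fac⇒factorization (done p) w e = [] , refl , [] , λ x → sym (trans (e x) (p x))
  Fac⇒factorization (step i j i≢j F) w e with Fac⇒factorization F (R i j · w) (λ x → cong (rf i j) (e x))
  ... | ts , len , ts-refl , eq = R i j ∷ ts , cong suc len , R-reflection i j i≢j ∷ ts-refl
      , λ x → trans (cong (rf i j) (eq x)) (rf-involutive i j _)

  ℓT⇒Min : (w : Bn n) → ℓT≡ w k → Min (fun w) k
  ℓT⇒Min w ((ts , refl , fac) , bound) = factorization⇒Fac ts w fac , lower-bound
    where
    lower-bound : ∀ l → Fac (fun w) l → length ts ≤ l
    lower-bound l F with Fac⇒factorization F w (λ _ → refl)
    ... | ts′ , refl , fac′ = bound ts′ fac′

  Min⇒ℓT : (w : Bn n) → Min (fun w) k → ℓT≡ w k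
  Min⇒ℓT w (F , F-min) = Fac⇒factorization F w (λ _ → refl) , λ ts fac → F-min _ (factorization⇒Fac ts w fac)

  ⊴⇒≤T : (u v : Bn n) → u ⊴ v → u ≤T v
  ⊴⇒≤T u v (j , k , C , U , V) = j + k , k , j , Min⇒ℓT v V , Min⇒ℓT u U
    , Min⇒ℓT (v · u ⁻¹) (subst (Fac _) (+-identityʳ j) (precomp (inv u) C ++ᶜ done (invʳ u)) , bound)
    , sym (m+n∸n≡m j k)
    where
    bound : ∀ l → Fac (fun v ∘ inv u) l → j ≤ l
    bound l F = +-cancelʳ-≤ k j l (proj₂ V (l + k)
      (chain-resp (λ x → cong (fun v) (invˡ u x)) (precomp (fun u) F) ++ᶜ proj₁ U))

  ≤T⇒⊴ : (u v : Bn n) → u ≤T v → u ⊴ v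
  ≤T⇒⊴ u v (a , b , d , ℓv , ℓu , ℓvu , d≡a∸b) = d , b , C , ℓT⇒Min u ℓu , subst (Min (fun v)) (sym d+b≡a) V
    where
    V = ℓT⇒Min v ℓv
    C : Chain (fun u) (fun v) d
    C = chain-resp (λ x → cong (fun v) (invˡ u x)) (precomp (fun u) (proj₁ (ℓT⇒Min (v · u ⁻¹) ℓvu)))
    b≤a : Chain (fun u) (fun v) d → d ≡ a ∸ b → b ≤ a
    b≤a C d≡ with b ≤? a
    ... | yes p = p
    -- If `a < b`, truncated subtraction gives `d = 0`; then `u` and `v` agree and have equal length
    -- after all.
    ... | no b≰a with refl ← trans d≡ (m≤n⇒m∸n≡0 (<⇒≤ (≰⇒> b≰a))) with C
    ...   | done e = ≤-reflexive (Min-unique (λ x → sym (e x)) (ℓT⇒Min u ℓu) V)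
    d+b≡a : d + b ≡ a
    d+b≡a = trans (cong (_+ b) d≡a∸b) (m∸n+n≡m (b≤a C d≡a∸b))

  ⊴-antisym : (u v : Bn n) → u ⊴ v → v ⊴ u → u ≈ v
  ⊴-antisym u v (zero , _ , done e , _) _ x = sym (e x)
  ⊴-antisym u v (suc j , k , _ , U , V) (j′ , k′ , _ , V′ , U′) =
    contradiction (≤-trans k<k′ k′≤k) (<-irrefl refl)
    where
    k<k′ : k < k′
    k<k′ = subst (k <_) (Min-unique {f = fun v} {g = fun v} (λ _ → refl) V V′) (s≤s (m≤n+m k j))
    k′≤k : k′ ≤ k
    k′≤k = subst (k′ ≤_) (Min-unique {f = fun u} {g = fun u} (λ _ → refl) U′ U) (m≤n+m k′ j′)

≤ᵇ-true : ∀ {a b} → a ≤ b → (a ≤ᵇ b) ≡ true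
≤ᵇ-true {a} {b} = dec-true (a ≤? b)

≤ᵇ-false : ∀ {a b} → b < a → (a ≤ᵇ b) ≡ false
≤ᵇ-false {a} {b} = dec-false (a ≤? b) ∘ <⇒≱

≤ᵇ-true⁻¹ : ∀ a b → (a ≤ᵇ b) ≡ true → a ≤ b
≤ᵇ-true⁻¹ a b e = ≤ᵇ⇒≤ a b (subst T (sym e) tt)

≤ᵇ-false⁻¹ : ∀ a b → (a ≤ᵇ b) ≡ false → b < a
≤ᵇ-false⁻¹ a b e with a ≤? b
... | no a≰b = ≰⇒> a≰b
... | yes a≤b = contradiction (trans (sym e) (≤ᵇ-true a≤b)) λ ()

≤ᵇ-cong : ∀ {a b c d} → (a ≤ b → c ≤ d) → (c ≤ d → a ≤ b) → (a ≤ᵇ b) ≡ (c ≤ᵇ d)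
≤ᵇ-cong {a} {b} f g with a ≤? b
... | yes a≤b = trans (≤ᵇ-true a≤b) (sym (≤ᵇ-true (f a≤b)))
... | no a≰b = trans (≤ᵇ-false (≰⇒> a≰b)) (sym (≤ᵇ-false (≰⇒> (a≰b ∘ g))))

xor-cancelʳ : ∀ a b c → a xor c ≡ b xor c → a ≡ b
xor-cancelʳ a b c e = trans (sym (lem a)) (trans (cong (_xor c) e) (lem b))
  where
  lem : ∀ x → (x xor c) xor c ≡ x
  lem x = solve 2 (λ x c → (x :+ c) :+ c := x) refl x c

-- Cuts, arcs and their behaviour under negation

module Cuts (n : ℕ) where
  open Reflections n
  open Lengths n

  -- h p x tells on which side of the cut just before p the point x lies; thus
  -- S p q is the indicator function of the interval [p , q) or [q , p).
  h : Pt n → Pt n → Bool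
  h p x = toℕ p ≤ᵇ toℕ x

  S : Pt n → Pt n → Pt n → Bool
  S p q x = h p x xor h q x

  sgn : Pt n → Bool
  sgn x = n ≤ᵇ toℕ x

  h-refl : ∀ p → h p p ≡ true
  h-refl p = ≤ᵇ-true {toℕ p} ≤-refl

  h-anti : ∀ p q → p ≢ q → h p q ≡ not (h q p)
  h-anti p q p≢q with toℕ q ≤? toℕ p
  ... | yes q≤p = trans (≤ᵇ-false (≤∧≢⇒< q≤p (p≢q ∘ sym ∘ toℕ-injective))) (cong not (sym (≤ᵇ-true q≤p)))
  ... | no q≰p = trans (≤ᵇ-true (<⇒≤ (≰⇒> q≰p))) (cong not (sym (≤ᵇ-false (≰⇒> q≰p))))

  sgn-neg : ∀ x → sgn (neg n x) ≡ not (sgn x)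
  sgn-neg x with half x
  ... | lower x<n e = trans (≤ᵇ-true (subst (n ≤_) (sym e) (m≤m+n n _))) (cong not (sym (≤ᵇ-false x<n)))
  ... | upper n≤x -x<n _ = trans (≤ᵇ-false -x<n) (cong not (sym (≤ᵇ-true n≤x)))

  h-self-neg : ∀ x → h x (neg n x) ≡ not (sgn x)
  h-self-neg x with half x
  ... | lower x<n e = trans (≤ᵇ-true (subst (toℕ x ≤_) (sym e) (m≤n+m _ n))) (cong not (sym (≤ᵇ-false x<n)))
  ... | upper n≤x -x<n _ = trans (≤ᵇ-false (≤-trans -x<n n≤x)) (cong not (sym (≤ᵇ-true n≤x)))

  h-neg : ∀ p x → h (neg n p) (neg n x) ≡ h p x xor (sgn p xor sgn x)
  h-neg p x with half p | half x
  ... | lower p<n ep | lower x<n ex rewrite ≤ᵇ-false p<n | ≤ᵇ-false x<n | ep | ex =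
    trans (≤ᵇ-cong (+-cancelˡ-≤ n _ _) (+-monoʳ-≤ n)) (sym (xor-identityʳ _))
  ... | lower p<n ep | upper n≤x -x<n ex
    rewrite ≤ᵇ-false p<n | ≤ᵇ-true n≤x | ≤ᵇ-true (≤-trans (<⇒≤ p<n) n≤x) | ep = ≤ᵇ-false (≤-trans -x<n (m≤m+n n _))
  ... | upper n≤p -p<n ep | lower x<n ex
    rewrite ≤ᵇ-true n≤p | ≤ᵇ-false x<n | ≤ᵇ-false (≤-trans x<n n≤p) | ex = ≤ᵇ-true (≤-trans (<⇒≤ -p<n) (m≤m+n n _))
  ... | upper n≤p -p<n ep | upper n≤x -x<n ex
    rewrite ≤ᵇ-true n≤p | ≤ᵇ-true n≤x =
    trans (≤ᵇ-cong (λ le → subst₂ _≤_ (sym ep) (sym ex) (+-monoʳ-≤ n le)) (λ le → +-cancelˡ-≤ n _ _ (subst₂ _≤_ ep ex le))) (sym (xor-identityʳ _))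

  -- Negation is a half turn of the circle and maps arcs to arcs, but the encoding may replace the
  -- image by its complement; the constant `sgn p xor sgn q` records this.
  S-neg : ∀ p q x → S (neg n p) (neg n q) (neg n x) ≡ S p q x xor (sgn p xor sgn q)
  S-neg p q x = trans (cong₂ _xor_ (h-neg p x) (h-neg q x))
    (solve 5 (λ a b c d s → (a :+ (c :+ s)) :+ (b :+ (d :+ s)) := (a :+ b) :+ (c :+ d)) refl
      (h p x) (h q x) (sgn p) (sgn q) (sgn x))

  S-sym : ∀ p q x → S p q x ≡ S q p x
  S-sym p q x = xor-comm (h p x) (h q x)

  -- A chord and its image under the half turn are parallel, so they do not cross. In `c-split` this
  -- shows that exchanging `neg n b` and `neg n d` does not disturb the arc between `b` and `d`.
  S-neg-ends : ∀ b d → neg n d ≢ b → S d b (neg n d) ≡ S d b (neg n b)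
  S-neg-ends b d ne = trans (cong₂ _xor_ (h-self-neg d) (h-anti b (neg n d) (ne ∘ sym)))
    (trans (solve 3 (λ H u v → (con true :+ u) :+ (con true :+ H) := (H :+ ((con true :+ u) :+ v)) :+ (con true :+ v)) refl
              (h (neg n d) b) (sgn d) (sgn b))
      (sym (cong₂ _xor_ hd-b (h-self-neg b))))
    where
    hd-b : h d (neg n b) ≡ h (neg n d) b xor (not (sgn d) xor sgn b)
    hd-b = trans (cong (λ z → h z (neg n b)) (sym (neg-involutive d)))
      (trans (h-neg (neg n d) b) (cong (λ z → h (neg n d) b xor (z xor sgn b)) (sgn-neg d)))

  Disjoint Codisjoint : (Pt n → Bool) → Set
  Disjoint f = ∀ x → f x ≡ true → f (neg n x) ≡ true → ⊥
  Codisjoint f = ∀ x → f x ≡ false → f (neg n x) ≡ false → ⊥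

  S-true : ∀ p q x → S p q x ≡ true → toℕ p ≤ toℕ q → toℕ p ≤ toℕ x × toℕ x < toℕ q
  S-true p q x e p≤q with h p x in ep | h q x in eq
  ... | true | false = ≤ᵇ-true⁻¹ _ _ ep , ≤ᵇ-false⁻¹ _ _ eq
  ... | false | true = contradiction (≤-trans p≤q (≤ᵇ-true⁻¹ _ _ eq)) (<⇒≱ (≤ᵇ-false⁻¹ _ _ ep))

  S-false : ∀ p q x → S p q x ≡ false → toℕ p ≤ toℕ q → toℕ x < toℕ p ⊎ toℕ q ≤ toℕ x
  S-false p q x e p≤q with h p x in ep | h q x in eq
  ... | true | true = inj₂ (≤ᵇ-true⁻¹ _ _ eq)
  ... | false | false = inj₁ (≤ᵇ-false⁻¹ _ _ ep)

  opposite : ∀ (f : Pt n → Bool) v → (∀ x y → toℕ y ≡ n + toℕ x → f x ≡ v → f y ≡ v → ⊥) →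
    ∀ x → f x ≡ v → f (neg n x) ≡ v → ⊥
  opposite f v H x ex e-x with half x
  ... | lower _ e = H x (neg n x) e ex e-x
  ... | upper _ _ e = H (neg n x) x e e-x ex

  -- At most `n` cyclically consecutive points contain no opposite pair; an arc with at least `n`
  -- points has a complement of this kind.
  S-disjoint-≤ : ∀ p q → toℕ p ≤ toℕ q → Disjoint (S p q) ⊎ Codisjoint (S p q)
  S-disjoint-≤ p q p≤q with ≤-total (toℕ q) (n + toℕ p)
  ... | inj₁ short = inj₁ (opposite (S p q) true λ x y e ex ey →
        let (p≤x , _) = S-true p q x ex p≤q; (_ , y<q) = S-true p q y ey p≤q
        in <⇒≱ (+-cancelˡ-< n _ _ (subst (_< n + toℕ p) e (≤-trans y<q short))) p≤x)
  ... | inj₂ long = inj₂ (opposite (S p q) false outside)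
    where
    outside : ∀ x y → toℕ y ≡ n + toℕ x → S p q x ≡ false → S p q y ≡ false → ⊥
    outside x y e ex ey with S-false p q x ex p≤q | S-false p q y ey p≤q
    ... | inj₂ q≤x | _ = <⇒≱ (toℕ<n y) (subst (n + n ≤_) (sym e) (+-monoʳ-≤ n (≤-trans (m≤m+n n _) (≤-trans long q≤x))))
    ... | inj₁ _   | inj₁ y<p = <⇒≱ (toℕ<n q) (≤-trans (+-monoʳ-≤ n (≤-trans (subst (n ≤_) (sym e) (m≤m+n n _)) (<⇒≤ y<p))) long)
    ... | inj₁ x<p | inj₂ q≤y = <⇒≱ x<p (+-cancelˡ-≤ n _ _ (≤-trans long (subst (toℕ q ≤_) e q≤y)))

  S-disjoint : ∀ p q → Disjoint (S p q) ⊎ Codisjoint (S p q)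
  S-disjoint p q with ≤-total (toℕ p) (toℕ q)
  ... | inj₁ p≤q = S-disjoint-≤ p q p≤q
  ... | inj₂ q≤p with S-disjoint-≤ q p q≤p
  ...   | inj₁ D = inj₁ λ x e e′ → D x (trans (S-sym q p _) e) (trans (S-sym q p _) e′)
  ...   | inj₂ D = inj₂ λ x e e′ → D x (trans (S-sym q p _) e) (trans (S-sym q p _) e′)

  -- A side containing an opposite pair must be the one not excluded by `S-disjoint`, which depends
  -- on the arc alone. This gives uniqueness of the zero block for both equivalences below.
  balanced-value : ∀ p q x y → S p q x ≡ S p q (neg n x) → S p q y ≡ S p q (neg n y) → S p q x ≡ S p q y
  balanced-value p q x y ex ey with S-disjoint p q
  ... | inj₁ D = trans (value x ex) (sym (value y ey))
    where
    value : ∀ z → S p q z ≡ S p q (neg n z) → S p q z ≡ false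
    value z e with S p q z in ez
    ... | true = ⊥-elim (D z ez (sym e))
    ... | false = refl
  ... | inj₂ D = trans (value x ex) (sym (value y ey))
    where
    value : ∀ z → S p q z ≡ S p q (neg n z) → S p q z ≡ true
    value z e with S p q z in ez
    ... | true = refl
    ... | false = ⊥-elim (D z ez (sym e))

  record K (w : Pt n → Pt n) (p q : Pt n) : Set where
    constructor invariant
    field at : ∀ x → S p q (w x) ≡ S p q x
  open K public

  K? : ∀ w p q → Dec (K w p q)
  K? w p q = map′ invariant at (all? λ x → S p q (w x) ≟ᵇ S p q x)

  K-refl : ∀ {w} p → K w p p
  K-refl {w} p .at x = trans (xor-same (h p (w x))) (sym (xor-same (h p x)))

  K-sym : ∀ {w p q} → K w p q → K w q p
  K-sym {w} {p} {q} r .at x = trans (S-sym q p (w x)) (trans (at r x) (S-sym p q x))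

  S-trans : ∀ p q r x → S p r x ≡ S p q x xor S q r x
  S-trans p q r x = solve 3 (λ a b c → a :+ c := (a :+ b) :+ (b :+ c)) refl (h p x) (h q x) (h r x)

  K-trans : ∀ {w p q r} → K w p q → K w q r → K w p r
  K-trans {w} {p} {q} {r} a b .at x = trans (S-trans p q r (w x)) (trans (cong₂ _xor_ (at a x) (at b x)) (sym (S-trans p q r x)))

  K-neg : ∀ (w : Bn n) {p q} → K (fun w) p q → K (fun w) (neg n p) (neg n q)
  K-neg w {p} {q} r .at x = begin
    S (neg n p) (neg n q) (fun w x)                        ≡⟨ cong (S (neg n p) (neg n q)) (trans (cong (fun w) (sym (neg-involutive x))) (odd w (neg n x))) ⟩
    S (neg n p) (neg n q) (neg n (fun w (neg n x)))        ≡⟨ S-neg p q _ ⟩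
    S p q (fun w (neg n x)) xor (sgn p xor sgn q)          ≡⟨ cong (_xor (sgn p xor sgn q)) (at r (neg n x)) ⟩
    S p q (neg n x) xor (sgn p xor sgn q)                  ≡⟨ sym (S-neg p q _) ⟩
    S (neg n p) (neg n q) (neg n (neg n x))                ≡⟨ cong (S (neg n p) (neg n q)) (neg-involutive x) ⟩
    S (neg n p) (neg n q) x                                ∎
    where open ≡-Reasoning

  K-rf : ∀ (w : Bn n) {p q} → K (fun w) p q → ∀ x → K (fun w) x (rf p q x)
  K-rf w {p} {q} r x with place p q x
  ... | fst  = subst (K _ _) (sym (rf-fst p q)) r
  ... | snd  = subst (K _ _) (sym (rf-snd p q)) (K-sym r)
  ... | -fst = subst (K _ _) (sym (rf-neg-fst p q)) (K-neg w r)
  ... | -snd = subst (K _ _) (sym (rf-neg-snd p q)) (K-neg w (K-sym r))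
  ... | off a b c d = subst (K _ _) (sym (rf-off p q x a b c d)) (K-refl x)

  -- x and y lie in the same block of the noncrossing closure of the cycles of w.
  NotSeparated : (Pt n → Pt n) → Pt n → Pt n → Set
  NotSeparated w x y = ∀ p q → K w p q → S p q x ≡ S p q y

  NotSeparated-admissible : (w : Bn n) → Admissible (NotSeparated (fun w))
  NotSeparated-admissible w = record
    { ~refl  = λ p q r → refl
    ; ~sym   = λ xy p q r → sym (xy p q r)
    ; ~trans = λ xy yz p q r → trans (xy p q r) (yz p q r)
    ; ~neg   = λ {x} {y} xy p q r → trans (flip p q x) (trans (cong (_xor (sgn (neg n p) xor sgn (neg n q))) (xy (neg n p) (neg n q) (K-neg w r))) (sym (flip p q y)))
    ; ~zero  = λ {x} {y} x0 y0 p q r → balanced-value p q x y (x0 p q r) (y0 p q r)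
    }
    where
    flip : ∀ p q x → S p q (neg n x) ≡ S (neg n p) (neg n q) x xor (sgn (neg n p) xor sgn (neg n q))
    flip p q x = trans (cong₂ (λ a b → S a b (neg n x)) (sym (neg-involutive p)) (sym (neg-involutive q))) (S-neg (neg n p) (neg n q) x)

  -- The second component makes the relation stable under negation, as a signed partition requires.
  SameSide : Pt n → Pt n → Pt n → Pt n → Set
  SameSide p q x y = S p q x ≡ S p q y × S p q (neg n x) ≡ S p q (neg n y)

  SameSide-admissible : ∀ p q → Admissible (SameSide p q)
  SameSide-admissible p q = record
    { ~refl  = refl , refl
    ; ~sym   = λ { (a , b) → sym a , sym b }
    ; ~trans = λ { (a , b) (c , d) → trans a c , trans b d }
    ; ~neg   = λ { {x} {y} (a , b) → b , trans (cong (S p q) (neg-involutive x)) (trans a (sym (cong (S p q) (neg-involutive y)))) }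
    ; ~zero  = λ { {x} {y} (a , _) (b , _) → let e = balanced-value p q x y a b in e , trans (sym a) (trans e b) }
    }

  ⊴-K : (u v : Bn n) → u ⊴ v → ∀ p q → K (fun v) p q → K (fun u) p q
  ⊴-K u v u⊴v p q r .at x = proj₁ (⊴-pres (SameSide-admissible p q) u v u⊴v
    (λ y → at r y , trans (cong (S p q) (sym (odd v y))) (at r (neg n y))) x)

iter-shift : {A : Set} (f : A → A) (m : ℕ) (x : A) → iter f m (f x) ≡ f (iter f m x)
iter-shift f zero x = refl
iter-shift f (suc m) x = cong f (iter-shift f m x)

-- The Coxeter element as a rotation, and noncrossing permutations

module Coxeter (n : ℕ) (c : Bn n) (cox : IsCoxeterElement c) where
  open Reflections n
  open Lengths n
  open Cuts n

  data Shift (x : Pt n) : Set where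
    inner : suc (toℕ x) < n + n → toℕ (fun c x) ≡ suc (toℕ x) → Shift x
    outer : suc (toℕ x) ≡ n + n → toℕ (fun c x) ≡ 0 → Shift x

  shift : ∀ x → Shift x
  shift x with m≤n⇒m<n∨m≡n (toℕ<n x)
  ... | inj₁ lt = inner lt (proj₁ cox x lt)
  ... | inj₂ eq = outer eq (proj₂ cox x eq)

  last : Pt n → Bool
  last x = (n + n) ≤ᵇ suc (toℕ x)

  h-c-hit : ∀ x → h (fun c x) x ≡ last x
  h-c-hit x with shift x
  ... | inner lt e rewrite e = trans (≤ᵇ-false {suc (toℕ x)} ≤-refl) (sym (≤ᵇ-false lt))
  ... | outer eq e rewrite e = sym (≤ᵇ-true (≤-reflexive (sym eq)))

  -- A step of `c` crosses the cut `p` only by landing on `p`; `last x` corrects for wrapping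
  -- around, and it cancels when two cuts are compared in `S`.
  h-c-miss : ∀ p x → fun c x ≢ p → h p (fun c x) ≡ h p x xor last x
  h-c-miss p x ne with shift x
  ... | inner lt e rewrite ≤ᵇ-false lt | e = trans
          (≤ᵇ-cong (λ le → ≤-pred (≤∧≢⇒< le (λ eq → ne (toℕ-injective (trans e (sym eq)))))) m≤n⇒m≤1+n)
          (sym (xor-identityʳ _))
  ... | outer eq e rewrite ≤ᵇ-true (≤-reflexive (sym eq)) | e
          | ≤ᵇ-true {toℕ p} {toℕ x} (≤-pred (subst (toℕ p <_) (sym eq) (toℕ<n p))) =
          ≤ᵇ-false (n≢0⇒n>0 λ z → ne (toℕ-injective (trans e (sym z))))

  h-c : ∀ j x → h (fun c j) x ≡ (toℕ j <ᵇ toℕ x) xor last j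
  h-c j x with shift j
  ... | inner lt e rewrite e | ≤ᵇ-false lt = sym (xor-identityʳ _)
  ... | outer eq e rewrite e | ≤ᵇ-true (≤-reflexive (sym eq))
          | ≤ᵇ-false {suc (toℕ j)} {toℕ x} (subst (toℕ x <_) (sym eq) (toℕ<n x)) = refl

  -- rf b d ∘ c splits the cycle c at the cuts b and d.
  c-split : ∀ b d → b ≢ d → K (rf b d ∘ fun c) d b
  c-split b d b≢d .at x = go (fun c x) refl
    where
    miss : ∀ p → fun c x ≢ p → h p (fun c x) xor last x ≡ h p x
    miss p ne = trans (cong (_xor last x) (h-c-miss p x ne))
      (solve 2 (λ x c → (x :+ c) :+ c := x) refl (h p x) (last x))
    miss-both : fun c x ≢ d → fun c x ≢ b → S d b (fun c x) ≡ S d b x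
    miss-both ne ne′ = trans
      (solve 3 (λ u v l → u :+ v := (u :+ l) :+ (v :+ l)) refl (h d (fun c x)) (h b (fun c x)) (last x))
      (cong₂ _xor_ (miss d ne) (miss b ne′))
    hit-d : fun c x ≡ d → S d b b ≡ S d b x
    hit-d refl = trans (cong₂ _xor_ (h-anti d b (b≢d ∘ sym)) (h-refl b))
      (trans (solve 2 (λ u l → (con true :+ u) :+ con true := l :+ (u :+ l)) refl (h b d) (last x))
        (cong₂ _xor_ (sym (h-c-hit x)) (miss b (b≢d ∘ sym))))
    hit-b : fun c x ≡ b → S d b d ≡ S d b x
    hit-b refl = trans (cong₂ _xor_ (h-refl d) (h-anti b d b≢d))
      (trans (solve 2 (λ u l → con true :+ (con true :+ u) := (u :+ l) :+ l) refl (h d b) (last x))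
        (cong₂ _xor_ (miss d b≢d) (sym (h-c-hit x))))
    go : ∀ y → fun c x ≡ y → S d b (rf b d y) ≡ S d b x
    go y e with place b d y
    ... | fst = trans (cong (S d b) (rf-fst b d)) (hit-b e)
    ... | snd = trans (cong (S d b) (rf-snd b d)) (hit-d e)
    ... | -fst with neg n b ≟ d
    ...   | yes -b≡d = trans (cong (S d b) (trans (rf-neg-fst b d) (neg-flip -b≡d))) (hit-d (trans e -b≡d))
    ...   | no -b≢d = trans (cong (S d b) (rf-neg-fst b d)) (trans (S-neg-ends b d (-b≢d ∘ neg-flip))
              (trans (cong (S d b) (sym e)) (miss-both (-b≢d ∘ trans (sym e)) (neg≢ b ∘ trans (sym e)))))
    go y e | -snd with neg n d ≟ b
    ...   | yes -d≡b = trans (cong (S d b) (trans (rf-neg-snd b d) (neg-flip -d≡b))) (hit-b (trans e -d≡b))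
    ...   | no -d≢b = trans (cong (S d b) (rf-neg-snd b d)) (trans (sym (S-neg-ends b d -d≢b))
              (trans (cong (S d b) (sym e)) (miss-both (neg≢ d ∘ trans (sym e)) (-d≢b ∘ trans (sym e)))))
    go y e | off y≢b y≢d y≢-b y≢-d = trans (cong (S d b) (trans (rf-off b d y y≢b y≢d y≢-b y≢-d) (sym e)))
            (miss-both (λ eq → y≢d (trans (sym e) eq)) (λ eq → y≢b (trans (sym e) eq)))

  infix 4 _⊑_
  _⊑_ : (Pt n → Pt n) → (Pt n → Pt n) → Set
  w ⊑ u = ∀ a → K w (fun c a) (u a)

  -- u lies below c split at the cuts u a and c a.
  noncrossing : (u : Bn n) → u ⊴ c → fun u ⊑ fun u
  noncrossing u (j , k , C , U , M) a with fun u a ≟ fun c a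
  ... | yes ua≡ca = subst (K (fun u) (fun c a)) (sym ua≡ca) (K-refl (fun c a))
  -- `c ∘ inv u` is a product of `j` reflections sending `u a` to `c a`; the exchange at `u a`
  -- shortens it, which leaves `u` below `split`.
  ... | no ua≢ca = below (exchange (fun u a) moved (subst (Fac _) (+-identityʳ j) (precomp (inv u) C ++ᶜ done (invʳ u))))
    where
    image : fun c (inv u (fun u a)) ≡ fun c a
    image = cong (fun c) (invˡ u a)
    moved : fun c (inv u (fun u a)) ≢ fun u a
    moved e = ua≢ca (trans (sym e) image)
    split : Bn n
    split = R (fun u a) (fun c a) · c
    below : (Σ ℕ λ l → j ≡ suc l × Fac (rf (fun u a) (fun c (inv u (fun u a))) ∘ fun c ∘ inv u) l) → K (fun u) (fun c a) (fun u a)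
    below (l , refl , F) = ⊴-K u split (l , k , D , U , Min-down ua≢ca M (D ++ᶜ proj₁ U)) _ _ (c-split (fun u a) (fun c a) ua≢ca)
      where
      D : Chain (fun u) (fun split) l
      D = chain-resp (λ x → cong₂ (rf (fun u a)) image (cong (fun c) (invˡ u x))) (precomp (fun u) F)

  -- The number of steps of c from p to x.
  opaque
    pos : Pt n → Pt n → ℕ
    pos p x = if h p x then toℕ x ∸ toℕ p else toℕ x + ((n + n) ∸ toℕ p)

    pos-≥ : ∀ p x → toℕ p ≤ toℕ x → pos p x ≡ toℕ x ∸ toℕ p
    pos-≥ p x le rewrite ≤ᵇ-true le = refl

    pos-< : ∀ p x → toℕ x < toℕ p → pos p x ≡ toℕ x + ((n + n) ∸ toℕ p)
    pos-< p x lt rewrite ≤ᵇ-false lt = refl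

  pos-refl : ∀ p → pos p p ≡ 0
  pos-refl p = trans (pos-≥ p p ≤-refl) (n∸n≡0 (toℕ p))

  pos-bound : ∀ p x → pos p x < n + n
  pos-bound p x with toℕ p ≤? toℕ x
  ... | yes le = subst (_< n + n) (sym (pos-≥ p x le)) (≤-trans (s≤s (m∸n≤m (toℕ x) (toℕ p))) (toℕ<n x))
  ... | no ¬le = subst (_< n + n) (sym (pos-< p x (≰⇒> ¬le)))
      (subst (toℕ x + ((n + n) ∸ toℕ p) <_) (m+[n∸m]≡n (<⇒≤ (toℕ<n p))) (+-monoˡ-< _ (≰⇒> ¬le)))

  pos-c : ∀ p y → fun c y ≢ p → pos p (fun c y) ≡ suc (pos p y)
  pos-c p y ne with shift y | toℕ p ≤? toℕ y
  ... | inner lt e | yes le = trans (pos-≥ p (fun c y) (subst (toℕ p ≤_) (sym e) (m≤n⇒m≤1+n le)))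
        (trans (cong (_∸ toℕ p) e) (trans (+-∸-assoc 1 le) (cong suc (sym (pos-≥ p y le)))))
  ... | inner lt e | no ¬le = trans (pos-< p (fun c y) (subst (_< toℕ p) (sym e) (≤∧≢⇒< (≰⇒> ¬le) (λ eq → ne (toℕ-injective (trans e eq))))))
        (trans (cong (_+ _) e) (cong suc (sym (pos-< p y (≰⇒> ¬le)))))
  ... | outer eq e | yes le = trans (pos-< p (fun c y) (subst (_< toℕ p) (sym e) (n≢0⇒n>0 λ z → ne (toℕ-injective (trans e (sym z))))))
        (trans (cong (_+ _) e) (trans (cong (_∸ toℕ p) (sym eq)) (trans (+-∸-assoc 1 le) (cong suc (sym (pos-≥ p y le))))))
  ... | outer eq e | no ¬le = contradiction (≤-pred (subst (toℕ p <_) (sym eq) (toℕ<n p))) ¬le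

  pos-last : ∀ a x → pos (fun c a) x ≤ pos (fun c a) a
  pos-last a x = ≤-pred (subst (pos (fun c a) x <_) (sym eq) (pos-bound (fun c a) x))
    where
    eq : suc (pos (fun c a) a) ≡ n + n
    eq with shift a
    ... | inner lt e = trans (cong suc (trans (pos-< (fun c a) a (subst (toℕ a <_) (sym e) ≤-refl)) (cong (λ z → toℕ a + ((n + n) ∸ z)) e)))
          (m+[n∸m]≡n (<⇒≤ lt))
    ... | outer eq e = trans (cong suc (trans (pos-≥ (fun c a) a (subst (_≤ toℕ a) (sym e) z≤n)) (cong (toℕ a ∸_) e))) eq

  -- Cutting the circle before `p` instead reverses a comparison exactly when `q` and `x` lie on
  -- different sides of `p`. The part of the correction depending on `x` cancels in `S-Sᵖ`.
  h-pos : ∀ p q x → h q x ≡ (pos p q ≤ᵇ pos p x) xor (h p q xor h p x)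
  h-pos p q x with toℕ p ≤? toℕ q | toℕ p ≤? toℕ x
  ... | yes pq | yes px rewrite pos-≥ p q pq | pos-≥ p x px | ≤ᵇ-true pq | ≤ᵇ-true px = trans
        (≤ᵇ-cong {toℕ q} {toℕ x} {toℕ q ∸ toℕ p} {toℕ x ∸ toℕ p} (∸-monoˡ-≤ (toℕ p))
          (λ le → subst₂ _≤_ (m∸n+n≡m pq) (m∸n+n≡m px) (+-monoˡ-≤ (toℕ p) le))) (sym (xor-identityʳ _))
  ... | yes pq | no ¬px rewrite pos-≥ p q pq | pos-< p x (≰⇒> ¬px) | ≤ᵇ-true pq | ≤ᵇ-false (≰⇒> ¬px) | ≤ᵇ-false (≤-trans (≰⇒> ¬px) pq)
        | ≤ᵇ-true (≤-trans (∸-monoˡ-≤ (toℕ p) (<⇒≤ (toℕ<n q))) (m≤n+m ((n + n) ∸ toℕ p) (toℕ x))) = refl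
  ... | no ¬pq | yes px rewrite pos-< p q (≰⇒> ¬pq) | pos-≥ p x px | ≤ᵇ-true px | ≤ᵇ-false (≰⇒> ¬pq) | ≤ᵇ-true (<⇒≤ (≤-trans (≰⇒> ¬pq) px))
        | ≤ᵇ-false (≤-trans (∸-monoˡ-< (toℕ<n x) px) (m≤n+m ((n + n) ∸ toℕ p) (toℕ q))) = refl
  ... | no ¬pq | no ¬px rewrite pos-< p q (≰⇒> ¬pq) | pos-< p x (≰⇒> ¬px) | ≤ᵇ-false (≰⇒> ¬pq) | ≤ᵇ-false (≰⇒> ¬px) = trans
        (≤ᵇ-cong {toℕ q} {toℕ x} {toℕ q + ((n + n) ∸ toℕ p)} {toℕ x + ((n + n) ∸ toℕ p)}
          (+-monoˡ-≤ _) (+-cancelʳ-≤ _ _ _)) (sym (xor-identityʳ _))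

  pos-injective : ∀ p {q x} → pos p q ≡ pos p x → q ≡ x
  pos-injective p {q} {x} e with q ≟ x
  ... | yes q≡x = q≡x
  ... | no q≢x = contradiction (trans (sym (trans (h-pos p q x) (trans (cong₂ _xor_ (≤ᵇ-true (≤-reflexive e)) (xor-comm (h p q) (h p x)))
        (trans (cong (_xor (h p x xor h p q)) (sym (≤ᵇ-true (≤-reflexive (sym e))))) (sym (h-pos p x q)))))) (h-anti q x q≢x))
        (not-¬ refl)

  -- S q r in the linear order obtained by cutting the circle before p.
  Sᵖ : Pt n → Pt n → Pt n → Pt n → Bool
  Sᵖ p q r x = (pos p q ≤ᵇ pos p x) xor (pos p r ≤ᵇ pos p x)

  S-Sᵖ : ∀ p q r x → S q r x ≡ Sᵖ p q r x xor (h p q xor h p r)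
  S-Sᵖ p q r x = trans (cong₂ _xor_ (h-pos p q x) (h-pos p r x))
    (solve 5 (λ a b c d s → (a :+ (c :+ s)) :+ (b :+ (d :+ s)) := (a :+ b) :+ (c :+ d)) refl
      (pos p q ≤ᵇ pos p x) (pos p r ≤ᵇ pos p x) (h p q) (h p r) (h p x))

  S⇒Sᵖ : ∀ p q r x y → S q r x ≡ S q r y → Sᵖ p q r x ≡ Sᵖ p q r y
  S⇒Sᵖ p q r x y e = xor-cancelʳ _ _ (h p q xor h p r) (trans (sym (S-Sᵖ p q r x)) (trans e (S-Sᵖ p q r y)))

  Sᵖ⇒S : ∀ p q r x y → Sᵖ p q r x ≡ Sᵖ p q r y → S q r x ≡ S q r y
  Sᵖ⇒S p q r x y e = trans (S-Sᵖ p q r x) (trans (cong (_xor (h p q xor h p r)) e) (sym (S-Sᵖ p q r y)))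

  K-iter : ∀ {u p q} → K u p q → ∀ m x → S p q (iter u m x) ≡ S p q x
  K-iter r zero x = refl
  K-iter r (suc m) x = trans (at r _) (K-iter r m x)

  -- Walking along a cycle of a noncrossing permutation

  module Walk (u : Pt n → Pt n) (u⊑u : u ⊑ u) (a : Pt n) where
    P : Pt n → ℕ
    P = pos (fun c a)

    point : ℕ → Pt n
    point m = iter u m (u a)

    P-c : ∀ y → P y < P a → P (fun c y) ≡ suc (P y)
    P-c y lt = pos-c (fun c a) y λ e → <-irrefl (cong P (fun-injective c e)) lt

    at-a : ∀ y → Sᵖ (fun c a) (fun c y) (u y) a ≡ false
    at-a y = cong₂ _xor_ (≤ᵇ-true (pos-last a (fun c y))) (≤ᵇ-true (pos-last a (u y)))

    -- The arc between `c y` and `u y` has `y` and `a` on the same side, since they share an orbit.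
    -- As `a` is last, it lies beyond both cuts; `y` lies before `c y`, hence also before `u y`.
    ascend : ∀ m → P (point m) < P a → P (point m) < P (u (point m))
    ascend m lt = ≤ᵇ-false⁻¹ _ _ (trans (sym (cong (_xor (P (u y) ≤ᵇ P y)) (trans (cong (_≤ᵇ P y) (P-c y lt)) (≤ᵇ-false {suc (P y)} ≤-refl))))
      (trans (S⇒Sᵖ _ (fun c y) (u y) y a (trans (K-iter (u⊑u y) m (u a)) (at (u⊑u y) a))) (at-a y)))
      where y = point m

    -- As `c y` is at or before `b` and `b` at or before `u y`, the arc from `c a` to `u y` is the
    -- union of the two given invariant arcs. These may overlap, so the Boolean disjunction is
    -- needed instead of `xor`.
    meet : ∀ (w : Pt n → Pt n) y b → P y < P a → P y < P b → P b ≤ P (u y) →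
      K w (fun c y) (u y) → K w (fun c a) b → K w (fun c a) (u y)
    meet w y b y<a y<b b≤uy r s .at x = Sᵖ⇒S p p (u y) (w x) x (trans (formula (w x))
      (trans (cong₂ (λ α β → not (not α ∧ not β)) (S⇒Sᵖ p p b (w x) x (at s x)) (S⇒Sᵖ p (fun c y) (u y) (w x) x (at r x)))
        (sym (formula x))))
      where
      p = fun c a
      from-p : ∀ r x → Sᵖ p p r x ≡ not (P r ≤ᵇ P x)
      from-p r x = cong (_xor (P r ≤ᵇ P x)) (cong (_≤ᵇ P x) (pos-refl p))
      formula : ∀ x → Sᵖ p p (u y) x ≡ not (not (Sᵖ p p b x) ∧ not (Sᵖ p (fun c y) (u y) x))
      formula x rewrite from-p (u y) x | from-p b x | P-c y y<a with P (u y) ≤? P x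
      ... | yes le rewrite ≤ᵇ-true le | ≤ᵇ-true (≤-trans b≤uy le) | ≤ᵇ-true (≤-trans y<b (≤-trans b≤uy le)) = refl
      ... | no ¬le with P b ≤? P x
      ...   | yes le′ rewrite ≤ᵇ-false (≰⇒> ¬le) | ≤ᵇ-true le′ | ≤ᵇ-true (≤-trans y<b le′) = refl
      ...   | no ¬le′ rewrite ≤ᵇ-false (≰⇒> ¬le) | ≤ᵇ-false (≰⇒> ¬le′) = refl

    -- The walk is stopped at its first point at or beyond `b`, and `meet` replaces `b` by that
    -- point of the cycle. By `ascend` the remaining distance to `b` bounds the walk.
    overtake : (w : Pt n → Pt n) → w ⊑ u → ∀ b → K w (fun c a) b → ∀ fuel m → P b ≤ fuel + P (point m) → P (point m) < P b →
      Σ ℕ λ m′ → K w (fun c a) (point m′) × P b ≤ P (point m′)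
    overtake w w⊑u b s zero m le lt = contradiction le (<⇒≱ lt)
    overtake w w⊑u b s (suc fuel) m le lt with P (point (suc m)) <? P b
    ... | yes lt′ = overtake w w⊑u b s fuel (suc m)
          (≤-trans le (subst (_≤ fuel + P (point (suc m))) (+-suc fuel _) (+-monoʳ-≤ fuel (ascend m (≤-trans lt (pos-last a b)))))) lt′
    ... | no ¬lt′ = suc m , meet w (point m) b (≤-trans lt (pos-last a b)) lt (≮⇒≥ ¬lt′) (w⊑u (point m)) s , ≮⇒≥ ¬lt′

    -- A step from `y` past `b` would put `b`, but not `a`, into the arc from `c y` to `u y`; so the
    -- walk cannot jump over `b`.
    reach : ∀ b → (∀ y → S (fun c y) (u y) a ≡ S (fun c y) (u y) b) → ∀ fuel m → P b ≤ fuel + P (point m) → P (point m) ≤ P b →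
      Σ ℕ λ m′ → point m′ ≡ b
    reach b same fuel m le py≤pb with point m ≟ b
    ... | yes e = m , e
    ... | no ne = go fuel le
      where
      y = point m
      y<b : P y < P b
      y<b = ≤∧≢⇒< py≤pb (ne ∘ pos-injective (fun c a))
      y<a : P y < P a
      y<a = ≤-trans y<b (pos-last a b)
      uy≤b : P (u y) ≤ P b
      uy≤b = ≤ᵇ-true⁻¹ _ _ (not-injective (trans (sym (cong (_xor (P (u y) ≤ᵇ P b)) (trans (cong (_≤ᵇ P b) (P-c y y<a)) (≤ᵇ-true y<b))))
        (trans (sym (S⇒Sᵖ _ (fun c y) (u y) a b (same y))) (at-a y))))
      go : ∀ fuel → P b ≤ fuel + P y → Σ ℕ λ m′ → point m′ ≡ b
      go zero le = contradiction le (<⇒≱ y<b)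
      go (suc fuel) le = reach b same fuel (suc m)
        (≤-trans le (subst (_≤ fuel + P (u y)) (+-suc fuel _) (+-monoʳ-≤ fuel (ascend m y<a)))) uy≤b

    first-before : ∀ b → S (fun c a) (u a) a ≡ S (fun c a) (u a) b → P (u a) ≤ P b
    first-before b same = ≤ᵇ-true⁻¹ (P (u a)) (P b) (not-injective (trans (sym (from-p b)) (trans (sym (S⇒Sᵖ p p (u a) a b same))
      (trans (from-p a) (cong not (≤ᵇ-true (pos-last a (u a))))))))
      where
      p = fun c a
      from-p : ∀ x → Sᵖ p p (u a) x ≡ not (P (u a) ≤ᵇ P x)
      from-p x = cong (λ t → (t ≤ᵇ P x) xor (P (u a) ≤ᵇ P x)) (pos-refl p)

    same-orbit : ∀ b → (∀ y → S (fun c y) (u y) a ≡ S (fun c y) (u y) b) → Σ ℕ λ m → iter u m a ≡ b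
    same-orbit b same =
      let (m , e) = reach b same (P b) 0 (m≤m+n (P b) (P (u a))) (first-before b (same a))
      in suc m , trans (sym (iter-shift u m a)) e

-- Construction and uniqueness of the join

module Join (n : ℕ) (c : Bn n) (cox : IsCoxeterElement c) where
  open Reflections n
  open Lengths n
  open Cuts n
  open Coxeter n c cox

  Tight : (Pt n → Pt n) → (Pt n → Pt n) → Set
  Tight w u = ∀ a b → K w (fun c a) b → pos (fun c a) b ≤ pos (fun c a) (u a)

  tight-unique : ∀ w u v → w ⊑ u → w ⊑ v → Tight w u → Tight w v → ∀ x → u x ≡ v x
  tight-unique w u v w⊑u w⊑v tu tv x = pos-injective (fun c x) (≤-antisym (tv x (u x) (w⊑u x)) (tu x (v x) (w⊑v x)))

  -- Where tightness fails at `a`, `overtake` finds a later related point in the cycle of `u a`.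
  -- Exchanging it with `u a` shortens `u`, and keeps `w ⊑ u` because the two cuts are related. The
  -- length `k` decreases.
  tighten : (w : Bn n) → ∀ k (u : Bn n) → Min (fun u) k → u ⊴ c → fun w ⊑ fun u →
    Σ (Bn n) λ v → v ⊴ u × fun w ⊑ fun v × Tight (fun w) (fun v)
  tighten w k u M u⊴c w⊑u
    with any? (λ a → any? λ b → K? (fun w) (fun c a) b ×-dec (pos (fun c a) (fun u a) <? pos (fun c a) b))
  ... | no none = u , ⊴-refl u , w⊑u , λ a b r → ≮⇒≥ λ lt → none (a , b , r , lt)
  ... | yes (a , b , r , lt) with Walk.overtake (fun u) (noncrossing u u⊴c) a (fun w) w⊑u b r (pos (fun c a) b) 0 (m≤m+n (pos (fun c a) b) (pos (fun c a) (fun u a))) lt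
  ...   | m , r′ , le with orbit-reflection u (fun u a) m (λ e → <⇒≱ lt (subst (λ z → pos (fun c a) b ≤ pos (fun c a) z) e le))
  ...     | k′ , M₁ , M₂ = descend k M (Min-unique {f = fun u} {g = fun u} (λ _ → refl) M M₁)
    where
    d b′ : Pt n
    d = fun u a
    b′ = iter (fun u) m d
    u′ : Bn n
    u′ = R d b′ · u
    d≢b′ : d ≢ b′
    d≢b′ e = <⇒≱ lt (subst (λ z → pos (fun c a) b ≤ pos (fun c a) z) (sym e) le)
    u′⊴u : u′ ⊴ u
    u′⊴u = reflect-⊴ u d b′ M₁ M₂ d≢b′
    descend : ∀ k → Min (fun u) k → k ≡ suc k′ → Σ (Bn n) λ v → v ⊴ u × fun w ⊑ fun v × Tight (fun w) (fun v)
    descend (suc k) M refl = let (v , v⊴u′ , w⊑v , tight) = tighten w k u′ M₂ (⊴-trans u′ u c u′⊴u u⊴c)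
                                   (λ x → K-trans (w⊑u x) (K-rf w (K-trans (K-sym (w⊑u a)) r′) (fun u x)))
                             in v , ⊴-trans v u′ u v⊴u′ u′⊴u , w⊑v , tight

  module _ (w : Bn n) where
    private
      tight-below : (u : Bn n) → u ⊴ c → fun w ⊑ fun u → Σ (Bn n) λ v → v ⊴ u × fun w ⊑ fun v × Tight (fun w) (fun v)
      tight-below u u⊴c w⊑u = let (k , M) = Min-exists u in tighten w k u M u⊴c w⊑u

      join-of-w = tight-below c (⊴-refl c) (λ a → K-refl (fun c a))

    opaque
      π₀ : Bn n
      π₀ = proj₁ join-of-w

      π₀⊴c : π₀ ⊴ c
      π₀⊴c = proj₁ (proj₂ join-of-w)

      w⊑π₀ : fun w ⊑ fun π₀
      w⊑π₀ = proj₁ (proj₂ (proj₂ join-of-w))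

      π₀-tight : Tight (fun w) (fun π₀)
      π₀-tight = proj₂ (proj₂ (proj₂ join-of-w))

    -- A reflection below `w` exchanges points that no `w`-invariant arc separates. The arcs
    -- attached to `u` are among these, so by `same-orbit` both points lie in one cycle of `u`.
    ⊑⇒upper : (u : Bn n) → u ⊴ c → fun w ⊑ fun u → ∀ t → IsReflection t → t ≤T w → t ≤T u
    ⊑⇒upper u u⊴c w⊑u t t-refl t≤w with reflection⇒rf t t-refl
    ... | i , j , i≢j , t≡rf = ⊴⇒≤T t u (⊴-respˡ (R i j) t u (λ x → sym (t≡rf x)) below)
      where
      i~j : NotSeparated (fun w) j i
      i~j = subst (λ z → NotSeparated (fun w) z i) (trans (t≡rf i) (rf-fst i j))
        (⊴-pres (NotSeparated-admissible w) t w (≤T⇒⊴ t w t≤w) (λ x p q r → at r x) i)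
      orbit : Σ ℕ λ m → iter (fun u) m i ≡ j
      orbit = Walk.same-orbit (fun u) (noncrossing u u⊴c) i j (λ y → sym (i~j (fun c y) (fun u y) (w⊑u y)))
      below : R i j ⊴ u
      below =
        let (m , e) = orbit
            (k , M , M′) = orbit-reflection u i m (λ e′ → i≢j (trans (sym e′) e))
        in reflection-⊴ u i j i≢j M (subst (λ z → Min (rf i z ∘ fun u) k) e M′)

    -- The reflection exchanging `x` and `w x` lies below `w`, hence below `u`, and inherits the
    -- invariance of the arcs that `u` itself preserves.
    upper⇒⊑ : (u : Bn n) → u ⊴ c → (∀ t → IsReflection t → t ≤T w → t ≤T u) → fun w ⊑ fun u
    upper⇒⊑ u u⊴c bound a .at x with fun w x ≟ x
    ... | yes wx≡x = cong (S (fun c a) (fun u a)) wx≡x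
    ... | no wx≢x with orbit-reflection w x 1 wx≢x
    ...   | k , M , M′ = subst (λ z → S (fun c a) (fun u a) z ≡ S (fun c a) (fun u a) x) (rf-fst x (fun w x))
              (at (⊴-K t u (≤T⇒⊴ t u (bound t (R-reflection x (fun w x) (wx≢x ∘ sym))
                (⊴⇒≤T t w (reflection-⊴ w x (fun w x) (wx≢x ∘ sym) M M′)))) _ _ (noncrossing u u⊴c a)) x)
      where
      t = R x (fun w x)

    π₀-isπT : IsπT w c π₀
    π₀-isπT = ⊴⇒≤T π₀ c π₀⊴c , ⊑⇒upper π₀ π₀⊴c w⊑π₀ , least
      where
      least : ∀ u → u ≤T c → (∀ t → IsReflection t → t ≤T w → t ≤T u) → π₀ ≤T u
      least u u≤c bound = ⊴⇒≤T π₀ u (⊴-respˡ v π₀ u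
          (tight-unique (fun w) (fun v) (fun π₀) w⊑v w⊑π₀ v-tight π₀-tight) v⊴u)
        where
        u⊴c = ≤T⇒⊴ u c u≤c
        found = tight-below u u⊴c (upper⇒⊑ u u⊴c bound)
        v = proj₁ found
        v⊴u = proj₁ (proj₂ found)
        w⊑v = proj₁ (proj₂ (proj₂ found))
        v-tight = proj₂ (proj₂ (proj₂ found))

    π₀-unique : ∀ π → IsπT w c π → π ≈ π₀
    π₀-unique π (π≤c , bound , least) = ⊴-antisym π π₀
      (≤T⇒⊴ π π₀ (least π₀ (⊴⇒≤T π₀ c π₀⊴c) (⊑⇒upper π₀ π₀⊴c w⊑π₀)))
      (≤T⇒⊴ π₀ π (proj₂ (proj₂ π₀-isπT) π π≤c bound))

-- Counting by sums of indicators

⟦_⟧ : Bool → ℕ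
⟦ b ⟧ = if b then 1 else 0

countᵇ-tabulate : ∀ {A : Set} {m} (p : A → Bool) (f : Fin m → A) → countᵇ p (tabulate f) ≡ sum (λ i → ⟦ p (f i) ⟧)
countᵇ-tabulate {m = zero} p f = refl
countᵇ-tabulate {m = suc m} p f with p (f Fin.zero)
... | true  = cong suc (countᵇ-tabulate p (f ∘ Fin.suc))
... | false = countᵇ-tabulate p (f ∘ Fin.suc)

allᵇ-tabulate : ∀ {A : Set} {m} (p : A → Bool) (f : Fin m → A) → (∀ i → p (f i) ≡ true) → allᵇ p (tabulate f) ≡ true
allᵇ-tabulate {m = zero} p f H = refl
allᵇ-tabulate {m = suc m} p f H rewrite H Fin.zero = allᵇ-tabulate p (f ∘ Fin.suc) (H ∘ Fin.suc)

allᵇ-tabulate⁻¹ : ∀ {A : Set} {m} (p : A → Bool) (f : Fin m → A) → allᵇ p (tabulate f) ≡ true → ∀ i → p (f i) ≡ true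
allᵇ-tabulate⁻¹ p f H Fin.zero = ∧-conicalˡ (p (f Fin.zero)) _ H
allᵇ-tabulate⁻¹ p f H (Fin.suc i) = allᵇ-tabulate⁻¹ p (f ∘ Fin.suc) (∧-conicalʳ (p (f Fin.zero)) _ H) i

sum-ones : ∀ m → sum {m} (λ _ → 1) ≡ m
sum-ones zero = refl
sum-ones (suc m) = cong suc (sum-ones m)

sum-mono-≤ : ∀ {m} {f g : Fin m → ℕ} → (∀ i → f i ≤ g i) → sum f ≤ sum g
sum-mono-≤ {zero} H = z≤n
sum-mono-≤ {suc m} H = +-mono-≤ (H Fin.zero) (sum-mono-≤ (H ∘ Fin.suc))

sum-zeros : ∀ m → sum {m} (λ _ → 0) ≡ 0
sum-zeros zero = refl
sum-zeros (suc m) = sum-zeros m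

sum-indicator : ∀ {m} (a : Fin m) → sum (λ i → ⟦ does (i ≟ a) ⟧) ≡ 1
sum-indicator {suc m} Fin.zero = cong suc (sum-zeros m)
sum-indicator {suc m} (Fin.suc a) = sum-indicator a

⟦⟧≤1 : ∀ b → ⟦ b ⟧ ≤ 1
⟦⟧≤1 true = ≤-refl
⟦⟧≤1 false = z≤n

count-two-false : ∀ {m} (p : Fin m → Bool) (a b : Fin m) → a ≢ b → p a ≡ false → p b ≡ false → countᵇ p (allFin m) ≤ m ∸ 2
count-two-false {m} p a b a≢b pa pb = subst (_≤ m ∸ 2) (sym (countᵇ-tabulate p id))
  (m+n≤o⇒m≤o∸n (sum P) (subst₂ _≤_ total (sum-ones m) (sum-mono-≤ pointwise)))
  where
  P A B : Fin m → ℕ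
  P i = ⟦ p i ⟧
  A i = ⟦ does (i ≟ a) ⟧
  B i = ⟦ does (i ≟ b) ⟧
  total : sum (λ i → P i + (A i + B i)) ≡ sum P + 2
  total = trans (∑-distrib-+ P _) (cong (sum P +_) (trans (∑-distrib-+ A B) (cong₂ _+_ (sum-indicator a) (sum-indicator b))))
  pointwise : ∀ i → P i + (A i + B i) ≤ 1
  pointwise i with i ≟ a | i ≟ b
  ... | yes refl | yes refl = contradiction refl a≢b
  ... | yes refl | no _ rewrite pa = ≤-refl
  ... | no _ | yes refl rewrite pb = ≤-refl
  ... | no _ | no _ rewrite +-identityʳ (P i) = ⟦⟧≤1 (p i)

count-one-false : ∀ {m} (p : Fin m → Bool) (a : Fin m) → p a ≡ false → (∀ i → i ≢ a → p i ≡ true) → countᵇ p (allFin m) ≡ m ∸ 1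
count-one-false {m} p a pa pi = trans (countᵇ-tabulate p id) (trans (sym (m+n∸n≡m (sum P) 1))
  (cong (_∸ 1) (trans (sym total) (trans (sum-cong-≗ pointwise) (sum-ones m)))))
  where
  P A : Fin m → ℕ
  P i = ⟦ p i ⟧
  A i = ⟦ does (i ≟ a) ⟧
  total : sum (λ i → P i + A i) ≡ sum P + 1
  total = trans (∑-distrib-+ P A) (cong (sum P +_) (sum-indicator a))
  pointwise : ∀ i → P i + A i ≡ 1
  pointwise i with i ≟ a
  ... | yes refl rewrite pa = refl
  ... | no i≢a rewrite pi i i≢a = refl

<ᵇ-true : ∀ {a b} → a < b → (a <ᵇ b) ≡ true
<ᵇ-true {a} {b} = dec-true (a <? b)

<ᵇ-false : ∀ {a b} → b ≤ a → (a <ᵇ b) ≡ false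
<ᵇ-false {a} {b} = dec-false (a <? b) ∘ ≤⇒≯

-- To be read with `a = w j` and `p = π j`. If `p < j`, the arc consists of the `x` with
-- `p ≤ x ≤ j`; it contains `j`, hence `a`. If `j < p`, it consists of the `x` strictly between and
-- contains neither. The last hypothesis excludes `a = j` with `p` different from `j`, where the
-- identity could fail.
balance : ∀ a p j → (j <ᵇ a) xor (p ≤ᵇ a) ≡ (j <ᵇ j) xor (p ≤ᵇ j) → (a ≡ j → p ≡ j) →
  ⟦ a <ᵇ p ⟧ + ⟦ p <ᵇ j ⟧ ≡ ⟦ a <ᵇ j ⟧
balance a p j k fixed rewrite <ᵇ-false {j} {j} ≤-refl with <-cmp p j | <-cmp a j
... | tri< p<j _ _ | tri> _ _ j<a
  rewrite <ᵇ-true j<a | ≤ᵇ-true (<⇒≤ (<-trans p<j j<a)) | ≤ᵇ-true (<⇒≤ p<j) = contradiction k λ ()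
... | tri< p<j p≢j _ | tri≈ _ a≡j _ = contradiction (fixed a≡j) p≢j
... | tri< p<j _ _ | tri< a<j _ _
  rewrite <ᵇ-false (<⇒≤ a<j) | ≤ᵇ-true (<⇒≤ p<j) | <ᵇ-false (≤ᵇ-true⁻¹ p a k) | <ᵇ-true p<j | <ᵇ-true a<j = refl
... | tri≈ _ refl _ | _ rewrite <ᵇ-false {p} {p} ≤-refl = +-identityʳ _
... | tri> _ _ j<p | tri> _ _ j<a
  rewrite <ᵇ-true j<a | ≤ᵇ-false j<p | <ᵇ-false (≤ᵇ-true⁻¹ p a (not-injective k)) | <ᵇ-false (<⇒≤ j<p) | <ᵇ-false (<⇒≤ j<a) = refl
... | tri> _ p≢j j<p | tri≈ _ a≡j _ = contradiction (fixed a≡j) p≢j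
... | tri> _ _ j<p | tri< a<j _ _
  rewrite <ᵇ-true (<-trans a<j j<p) | <ᵇ-false (<⇒≤ j<p) | <ᵇ-true a<j = refl

-- Antiexceedances and cycle minima

module Antiexceedances (n : ℕ) (c : Bn n) (cox : IsCoxeterElement c) where
  open Reflections n
  open Cuts n
  open Coxeter n c cox

  module _ (z : Pt n) (z-last : suc (toℕ z) ≡ n + n) where

    ≤z : ∀ (x : Pt n) → toℕ x ≤ toℕ z
    ≤z x = ≤-pred (subst (toℕ x <_) (sym z-last) (toℕ<n x))

    aexc-c⁻¹ : aexc (c ⁻¹) ≡ (n + n) ∸ 1
    aexc-c⁻¹ = count-one-false (λ i → toℕ i <ᵇ toℕ (fun c i)) z (<ᵇ-false (≤z (fun c z))) λ i i≢z → <ᵇ-true (up i i≢z)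
      where
      up : ∀ i → i ≢ z → toℕ i < toℕ (fun c i)
      up i i≢z with shift i
      ... | inner _ e = ≤-reflexive (sym e)
      ... | outer eq _ = contradiction (toℕ-injective (suc-injective (trans eq (sym z-last)))) i≢z

    module _ (w : Bn n) (up : ∀ i → i ≢ z → toℕ i < toℕ (inv w i)) where

      -- Downward induction from the top: a value of `inv w` at `i` above `i + 1` has already been
      -- taken at its own predecessor, which is larger than `i`.
      inv-successor : ∀ fuel i → suc (toℕ i) < n + n → n + n ≤ fuel + toℕ i → toℕ (inv w i) ≡ suc (toℕ i)
      inv-successor zero i _ le = contradiction le (<⇒≱ (toℕ<n i))
      inv-successor (suc fuel) i i-inner le with toℕ (inv w i) ℕ≟ suc (toℕ i) | shift (inv c (inv w i))
      ... | yes eq | _ = eq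
      ... | no _ | outer _ eq = contradiction (subst (toℕ i <_) (trans (sym (cong toℕ (invʳ c (inv w i)))) eq) i<wi) λ ()
        where
        i<wi : toℕ i < toℕ (inv w i)
        i<wi = up i λ i≡z → <-irrefl (trans (cong (suc ∘ toℕ) i≡z) z-last) i-inner
      ... | no ne | inner i′-inner eq = contradiction i<i′ (<-irrefl (cong toℕ (sym i′≡i)))
        where
        i′ = inv c (inv w i)
        wi≡ : toℕ (inv w i) ≡ suc (toℕ i′)
        wi≡ = trans (sym (cong toℕ (invʳ c (inv w i)))) eq
        i<wi : toℕ i < toℕ (inv w i)
        i<wi = up i λ i≡z → <-irrefl (trans (cong (suc ∘ toℕ) i≡z) z-last) i-inner
        i<i′ : toℕ i < toℕ i′
        i<i′ = ≤-pred (subst (suc (toℕ i) <_) wi≡ (≤∧≢⇒< i<wi (ne ∘ sym)))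
        i′≡i : i′ ≡ i
        i′≡i = fun-injective (w ⁻¹) (toℕ-injective (trans (inv-successor fuel i′ i′-inner
          (≤-trans le (subst (_≤ fuel + toℕ i′) (+-suc fuel (toℕ i)) (+-monoʳ-≤ fuel i<i′)))) (sym wi≡)))

      inv≡c : ∀ i → inv w i ≡ fun c i
      inv≡c i with shift i
      ... | inner lt eq = toℕ-injective (trans (inv-successor (n + n) i lt (m≤m+n (n + n) (toℕ i))) (sym eq))
      -- Inner points take only positive positions as values, so position 0 can come only from the
      -- last point.
      ... | outer i-last eq with shift (fun w (fun c i))
      ...   | inner lt _ = contradiction (trans (sym (inv-successor (n + n) (fun w (fun c i)) lt (m≤m+n (n + n) (toℕ (fun w (fun c i))))))
                (trans (cong toℕ (invˡ w (fun c i))) eq)) λ ()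
      ...   | outer x-last _ = trans (cong (inv w) (toℕ-injective (suc-injective (trans i-last (sym x-last))))) (invˡ w (fun c i))

      ≈c⁻¹ : w ≈ c ⁻¹
      ≈c⁻¹ x = trans (cong (fun w) (trans (sym (invʳ c x)) (sym (inv≡c (inv c x))))) (invʳ w (inv c x))

    aexc-≤ : (w : Bn n) → ¬ (w ≈ c ⁻¹) → aexc w ≤ (n + n) ∸ 2
    aexc-≤ w w≉ with any? (λ i → ¬? (i ≟ z) ×-dec ¬? (toℕ i <? toℕ (inv w i)))
    ... | yes (i , i≢z , ≮) = count-two-false (λ i → toℕ i <ᵇ toℕ (inv w i)) z i (i≢z ∘ sym) (<ᵇ-false (≤z (inv w z))) (<ᵇ-false (≮⇒≥ ≮))
    ... | no none = contradiction (≈c⁻¹ w λ i i≢z → decidable-stable (toℕ i <? toℕ (inv w i)) λ ≮ → none (i , i≢z , ≮)) w≉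

  -- The cut before `c j` is the cut after `j`, and stated so it involves no wrapping around: the
  -- constant `last j` cancels.
  K-linear : ∀ {w j q} → K w (fun c j) q → ∀ x →
    (toℕ j <ᵇ toℕ (w x)) xor h q (w x) ≡ (toℕ j <ᵇ toℕ x) xor h q x
  K-linear {w} {j} {q} r x = xor-cancelʳ _ _ (last j) (trans (sym (move (w x))) (trans (at r x) (move x)))
    where
    move : ∀ y → S (fun c j) q y ≡ ((toℕ j <ᵇ toℕ y) xor h q y) xor last j
    move y = trans (cong (_xor h q y) (h-c j y))
      (solve 3 (λ a b l → (a :+ l) :+ b := (a :+ b) :+ l) refl (toℕ j <ᵇ toℕ y) (h q y) (last j))

  antiexceedance-balance : ∀ {w π : Pt n → Pt n} → w ⊑ π → (∀ j → w j ≡ j → π j ≡ j) →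
    ∀ j → ⟦ toℕ (w j) <ᵇ toℕ (π j) ⟧ + ⟦ toℕ (π j) <ᵇ toℕ j ⟧ ≡ ⟦ toℕ (w j) <ᵇ toℕ j ⟧
  antiexceedance-balance {w} {π} w⊑π fixed j = balance (toℕ (w j)) (toℕ (π j)) (toℕ j)
    (K-linear (w⊑π j) j) (λ eq → cong toℕ (fixed j (toℕ-injective eq)))

  module _ (π : Bn n) (π⊑π : fun π ⊑ fun π) where

    private
      side : Pt n → Pt n → Bool
      side j x = (toℕ j <ᵇ toℕ x) xor h (fun π j) x

      side-iter : ∀ j m x → side j (iter (fun π) m x) ≡ side j x
      side-iter j zero x = refl
      side-iter j (suc m) x = trans (K-linear (π⊑π j) _) (side-iter j m x)

    -- The points from `π j` up to `j` form a `π`-invariant arc containing `π j`, hence its whole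
    -- cycle.
    cycle-above : ∀ j → toℕ (fun π j) < toℕ j → ∀ m → toℕ (fun π j) ≤ toℕ (iter (fun π) m (fun π j))
    cycle-above j πj<j m = ≮⇒≥ λ y<i → contradiction (trans (sym (outside y<i)) (trans (side-iter j m i) inside)) λ ()
      where
      i = fun π j
      y = iter (fun π) m i
      inside : side j i ≡ true
      inside = cong₂ _xor_ (<ᵇ-false (<⇒≤ πj<j)) (h-refl i)
      outside : toℕ y < toℕ i → side j y ≡ false
      outside y<i = cong₂ _xor_ (<ᵇ-false (<⇒≤ (<-trans y<i πj<j))) (≤ᵇ-false y<i)

    -- `isCycleMin` tests only `2n` iterates, so instead of following the cycle back to `j` the walk
    -- is shown to rise for as long. A first failure at `y` would make `π y` equal to `i = π j`,
    -- hence `y = j`, although `j` lies below `i` and `y` does not.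
    cycle-ascends : ∀ j → toℕ j < toℕ (fun π j) → (∀ m → m < n + n → toℕ (fun π j) ≤ toℕ (iter (fun π) m (fun π j))) →
      ∀ m → m < n + n → m + toℕ (fun π j) ≤ toℕ (iter (fun π) m (fun π j))
    cycle-ascends j j<i above zero _ = ≤-refl
    cycle-ascends j j<i above (suc m) m<N = ≤-trans (s≤s (cycle-ascends j j<i above m (<⇒≤ m<N))) (≰⇒> descent)
      where
      i = fun π j
      y = iter (fun π) m i
      i≤y : toℕ i ≤ toℕ y
      i≤y = above m (<⇒≤ m<N)
      descent : ¬ (toℕ (fun π y) ≤ toℕ y)
      descent πy≤y = <-irrefl refl (≤-trans j<i (subst (λ t → toℕ i ≤ toℕ t) y≡j i≤y))
        where
        side-i : side y i ≡ true
        side-i = trans (sym (side-iter y m i)) (cong₂ _xor_ (<ᵇ-false {toℕ y} ≤-refl) (≤ᵇ-true πy≤y))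
        πy≤i : toℕ (fun π y) ≤ toℕ i
        πy≤i = ≤ᵇ-true⁻¹ (toℕ (fun π y)) (toℕ i) (trans (cong (_xor h (fun π y) i) (sym (<ᵇ-false i≤y))) side-i)
        y≡j : y ≡ j
        y≡j = fun-injective π (toℕ-injective (≤-antisym πy≤i (above (suc m) m<N)))

    isCycleMin-inv : ∀ i → isCycleMin π i ≡ (toℕ i <ᵇ toℕ (inv π i))
    isCycleMin-inv i with <-cmp (toℕ i) (toℕ (inv π i))
    ... | tri< i<j i≢j _ rewrite dec-false (fun π i ≟ i) (λ eq → i≢j (cong toℕ (trans (sym (invˡ π i)) (cong (inv π) eq)))) =
      trans (allᵇ-tabulate {m = n + n} (λ m → toℕ i ≤ᵇ toℕ (iter (fun π) (toℕ m) i)) id (λ m → ≤ᵇ-true (subst (λ t → toℕ t ≤ toℕ (iter (fun π) (toℕ m) t)) (invʳ π i)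
              (cycle-above (inv π i) (subst (λ t → toℕ t < toℕ (inv π i)) (sym (invʳ π i)) i<j) (toℕ m)))))
        (sym (<ᵇ-true i<j))
    ... | tri≈ _ i≡j _ rewrite dec-true (fun π i ≟ i) (trans (cong (fun π) (toℕ-injective i≡j)) (invʳ π i)) = sym (<ᵇ-false (≤-reflexive (sym i≡j)))
    ... | tri> _ _ j<i with isCycleMin π i in eq
    ...   | false = sym (<ᵇ-false (<⇒≤ j<i))
    -- Since `j < i`, the position of `i` is at least 1, so `2n - 1` ascents from it leave the
    -- range.
    ...   | true = contradiction (toℕ<n (iter (fun π) (pred (n + n)) (fun π j))) (≤⇒≯ (≤-trans too-far (cycle-ascends j j<πj above (pred (n + n)) (≤-reflexive N≡))))
      where
      j = inv π i
      j<πj : toℕ j < toℕ (fun π j)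
      j<πj = subst (λ t → toℕ j < toℕ t) (sym (invʳ π i)) j<i
      all-above : allᵇ (λ m → toℕ i ≤ᵇ toℕ (iter (fun π) (toℕ m) i)) (allFin (n + n)) ≡ true
      all-above = ∧-conicalʳ (not (does (fun π i ≟ i))) _ eq
      above : ∀ m → m < n + n → toℕ (fun π j) ≤ toℕ (iter (fun π) m (fun π j))
      above m m<N rewrite invʳ π i = ≤ᵇ-true⁻¹ (toℕ i) (toℕ (iter (fun π) m i)) (subst (λ t → (toℕ i ≤ᵇ toℕ (iter (fun π) t i)) ≡ true) (toℕ-fromℕ< m<N)
        (allᵇ-tabulate⁻¹ (λ m → toℕ i ≤ᵇ toℕ (iter (fun π) (toℕ m) i)) id all-above (fromℕ< m<N)))
      N≡ : suc (pred (n + n)) ≡ n + n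
      N≡ = suc-pred (n + n) ⦃ >-nonZero (≤-trans (s≤s z≤n) (toℕ<n i)) ⦄
      too-far : n + n ≤ pred (n + n) + toℕ (fun π j)
      too-far = subst (_≤ pred (n + n) + toℕ (fun π j)) (trans (+-comm (pred (n + n)) 1) N≡)
        (+-monoʳ-≤ (pred (n + n)) (≤-trans (s≤s z≤n) j<πj))

  module _ (w π : Bn n) (w⊑π : fun w ⊑ fun π) (π⊑π : fun π ⊑ fun π) (fixed : ∀ j → fun w j ≡ j → fun π j ≡ j) where

    private
      count-along : (v : Bn n) (f : Pt n → Pt n → Bool) →
        countᵇ (λ i → f i (inv v i)) (allFin (n + n)) ≡ sum (λ j → ⟦ f (fun v j) j ⟧)
      count-along v f = trans (countᵇ-tabulate (λ i → f i (inv v i)) id) (trans (sum-permute (λ i → ⟦ f i (inv v i) ⟧) (permutation (fun v) (inv v) (invʳ v) (invˡ v)))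
        (sum-cong-≗ λ j → cong (λ t → ⟦ f (fun v j) t ⟧) (invˡ v j)))

    aexc-Pop : aexc (Pop w π) + cyc>1 π ≡ aexc w
    aexc-Pop = begin
      -- `inv (Pop w π) i` unfolds to `fun π (inv w i)`; reindexing by `i = w j` and by `i = π j`
      -- turns both counts into sums over the same `j`.
      aexc (Pop w π) + cyc>1 π                           ≡⟨ cong₂ _+_ (count-along w (λ i j → toℕ i <ᵇ toℕ (fun π j))) cycles ⟩
      sum (λ j → ⟦ toℕ (fun w j) <ᵇ toℕ (fun π j) ⟧) + sum (λ j → ⟦ toℕ (fun π j) <ᵇ toℕ j ⟧)
                                                         ≡⟨ sym (∑-distrib-+ (λ j → ⟦ toℕ (fun w j) <ᵇ toℕ (fun π j) ⟧) (λ j → ⟦ toℕ (fun π j) <ᵇ toℕ j ⟧)) ⟩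
      sum (λ j → ⟦ toℕ (fun w j) <ᵇ toℕ (fun π j) ⟧ + ⟦ toℕ (fun π j) <ᵇ toℕ j ⟧)
                                                         ≡⟨ sum-cong-≗ (antiexceedance-balance w⊑π fixed) ⟩
      sum (λ j → ⟦ toℕ (fun w j) <ᵇ toℕ j ⟧)             ≡⟨ sym (count-along w (λ i j → toℕ i <ᵇ toℕ j)) ⟩
      aexc w                                             ∎
      where
      open ≡-Reasoning
      cycles : cyc>1 π ≡ sum (λ j → ⟦ toℕ (fun π j) <ᵇ toℕ j ⟧)
      cycles = trans (countᵇ-tabulate (isCycleMin π) id) (trans (sum-cong-≗ (λ i → cong ⟦_⟧ (isCycleMin-inv π π⊑π i)))
        (trans (sym (countᵇ-tabulate (λ i → toℕ i <ᵇ toℕ (inv π i)) id)) (count-along π (λ i j → toℕ i <ᵇ toℕ j))))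

-- The effect of Pop

module Pops (n : ℕ) (c : Bn n) (cox : IsCoxeterElement c) (w : Bn n) where
  open Reflections n
  open Cuts n
  open Coxeter n c cox
  open Join n c cox
  open Antiexceedances n c cox

  -- The cuts before `j` and before `c j` enclose only `j`, so they are related when `w` fixes `j`;
  -- no later cut exists, and tightness forces `j` itself.
  π₀-fixed : ∀ j → fun w j ≡ j → fun (π₀ w) j ≡ j
  π₀-fixed j wj≡j = pos-injective (fun c j) (≤-antisym (pos-last j (fun (π₀ w) j)) (π₀-tight w j j alone))
    where
    at-j : ∀ x → (toℕ j <ᵇ toℕ x) xor h j x ≡ does (x ≟ j)
    at-j x with <-cmp (toℕ j) (toℕ x)
    ... | tri< lt ne _ rewrite <ᵇ-true lt | ≤ᵇ-true (<⇒≤ lt) = sym (dec-false (x ≟ j) (ne ∘ sym ∘ cong toℕ))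
    ... | tri≈ _ eq _ rewrite <ᵇ-false (≤-reflexive (sym eq)) | ≤ᵇ-true (≤-reflexive eq) = sym (dec-true (x ≟ j) (toℕ-injective (sym eq)))
    ... | tri> _ ne gt rewrite <ᵇ-false (<⇒≤ gt) | ≤ᵇ-false gt = sym (dec-false (x ≟ j) (ne ∘ sym ∘ cong toℕ))
    moves-with : ∀ x → does (fun w x ≟ j) ≡ does (x ≟ j)
    moves-with x with x ≟ j
    ... | yes refl = dec-true (fun w x ≟ x) wj≡j
    ... | no x≢j = dec-false (fun w x ≟ j) λ eq → x≢j (fun-injective w (trans eq (sym wj≡j)))
    alone : K (fun w) (fun c j) j
    alone .at x = trans (form (fun w x)) (trans (cong (_xor last j) (moves-with x)) (sym (form x)))
      where
      form : ∀ y → S (fun c j) j y ≡ does (y ≟ j) xor last j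
      form y = trans (cong (_xor h j y) (h-c j y))
        (trans (solve 3 (λ a b l → (a :+ l) :+ b := (a :+ b) :+ l) refl (toℕ j <ᵇ toℕ y) (h j y) (last j))
          (cong (_xor last j) (at-j y)))

  pop-balance : ∀ π → IsπT w c π → aexc (Pop w π) + cyc>1 π ≡ aexc w
  pop-balance π isπ = aexc-Pop w π
    (λ a → subst (K _ _) (sym (π≈ a)) (w⊑π₀ w a))
    (noncrossing π (Lengths.≤T⇒⊴ n π c (proj₁ isπ)))
    (λ j wj≡j → trans (π≈ j) (π₀-fixed j wj≡j))
    where
    π≈ : π ≈ π₀ w
    π≈ = π₀-unique w π isπ

theorem5p6 : (n : ℕ) → 2 ≤ n → (c : Bn n) → IsCoxeterElement c →
    (aexc (c ⁻¹) ≡ (n + n) ∸ 1)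
    × (∀ (w : Bn n) → ¬ (w ≈ c ⁻¹) → aexc w ≤ (n + n) ∸ 2)
    × (∀ (w : Bn n) →
    Σ (Bn n) (λ π → IsπT w c π)
    × (∀ (π : Bn n) → IsπT w c π → aexc (Pop w π) + cyc>1 π ≡ aexc w))
theorem5p6 n@(suc m) _ c cox = aexc-c⁻¹ z z-last , aexc-≤ z z-last , λ w → (π₀ w , π₀-isπT w) , Pops.pop-balance n c cox w
  where
  open Join n c cox
  open Antiexceedances n c cox
  z : Pt n
  -- As `n` is `suc m`, this is position `2n - 1`, the greatest point for `≺`.
  z = fromℕ (m + n)
  z-last : suc (toℕ z) ≡ n + n
  z-last = cong suc (toℕ-fromℕ (m + n))
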